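{- For every forest $F$ on $n \ge 1$ vertices: (i) $\alpha_{\rm reg}(F) \ge \frac{n+2}{5}$; (ii) $\alpha_{1-\mathrm{reg}}(F) \ge \frac{2(n+2)}{9}$; and (iii) $\alpha_{k-\mathrm{reg}}(F) \ge \frac{n+2}{4}$ for every integer $k \ge 2$. Moreover, all bounds are sharp: there are infinitely many forests $F$ (with $n$ the order of $F$) satisfying $\alpha_{\rm reg}(F) = \frac{n+2}{5}$, infinitely many satisfying $\alpha_{1-\mathrm{reg}}(F) = \frac{2(n+2)}{9}$, and for every integer $k \ge 2$ infinitely many satisfying $\alpha_{k-\mathrm{reg}}(F) = \frac{n+2}{4}$.
   Context: Graphs are finite and simple. For an integer $k \ge 0$, a $k$-independent set of a graph $G$ is a set of vertices whose induced subgraph has maximum degree at most $k$. The regular $k$-independence number $\alpha_{k-\mathrm{reg}}(G)$ is the maximum cardinality of a $k$-independent set of $G$ all of whose vertices have the same degree in $G$, and $\alpha_{\rm reg}(G) = \alpha_{0-\mathrm{reg}}(G)$, i.e. the maximum cardinality of an independent set of vertices of equal degree in $G$. -}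

module Defs where

open import Data.Fin.Base using (Fin)
open import Data.Fin.Properties using (all?)
open import Data.Fin.Subset using (Subset; _∈_; _∩_; ∣_∣; ⊥)
open import Data.Fin.Subset.Properties using (_∈?_; anySubset?; ∣p∣≤n; ∣⊥∣≡0; ∉⊥)
open import Data.List.Base using (List; _∷_; [_]; _++_; length; filter; upTo)
open import Data.List.Extrema.Nat using (max; xs≤max; argmax-all)
open import Data.List.Membership.Propositional.Properties
  using (∈-filter⁺; ∈-upTo⁺)
open import Data.List.Relation.Unary.All using (lookup)
open import Data.List.Relation.Unary.All.Properties using (all-filter)
open import Data.List.Relation.Unary.Linked using (Linked)
open import Data.List.Relation.Unary.Unique.Propositional using (Unique)
open import Data.Nat.Base using (ℕ; suc; _≤_; s≤s)
open import Data.Nat.Properties using (_≟_; _≤?_)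
open import Data.Product.Base using (Σ; ∃-syntax; _×_; _,_)
open import Data.Vec.Base using (tabulate)
open import Function.Base using (id)
open import Function.Bundles using (_↔_; _⇔_; Inverse)
open import Level using (0ℓ)
open import Relation.Binary.Core using (Rel)
open import Relation.Binary.Definitions using (Decidable; Irreflexive; Symmetric)
open import Relation.Binary.PropositionalEquality.Core using (_≡_; refl)
open import Relation.Nullary.Decidable.Core using (Dec; does; _×-dec_; _→-dec_)
open import Relation.Nullary.Negation.Core using (¬_; contradiction)

record Graph : Set₁ where
  infix 4 _~_ _~?_
  field
    order : ℕ

  Vertex : Set
  Vertex = Fin order

  field
    _~_      : Rel Vertex 0ℓ
    _~?_     : Decidable _~_
    ~-sym    : Symmetric _~_
    ~-irrefl : Irreflexive _≡_ _~_

  neighbours : Vertex → Subset order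
  neighbours v = tabulate (λ u → does (v ~? u))

  degree : Vertex → ℕ
  degree v = ∣ neighbours v ∣

  -- For v ∈ S this is the degree of v in the subgraph induced by S.
  degreeIn : Subset order → Vertex → ℕ
  degreeIn S v = ∣ neighbours v ∩ S ∣

  -- The cycle v, v₁, …, vₘ, v with m ≥ 2, where vs = v₁ ∷ … ∷ vₘ.
  IsCycle : Vertex → List Vertex → Set
  IsCycle v vs =
    2 ≤ length vs × Unique (v ∷ vs) × Linked _~_ (v ∷ vs ++ [ v ])

  Independent : ℕ → Subset order → Set
  Independent k S = ∀ v → v ∈ S → degreeIn S v ≤ k

  EqualDegrees : Subset order → Set
  EqualDegrees S = ∀ u v → u ∈ S → v ∈ S → degree u ≡ degree v

  RegIndependent : ℕ → Subset order → Set
  RegIndependent k S = Independent k S × EqualDegrees S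

  regIndependent? : ∀ k S → Dec (RegIndependent k S)
  regIndependent? k S =
    all? (λ v → (v ∈? S) →-dec (degreeIn S v ≤? k))
      ×-dec
    all? (λ u → all? (λ v →
      (u ∈? S) →-dec ((v ∈? S) →-dec (degree u ≟ degree v))))

  HasRegIndependent : ℕ → ℕ → Set
  HasRegIndependent k m = ∃[ S ] RegIndependent k S × ∣ S ∣ ≡ m

  hasRegIndependent? : ∀ k m → Dec (HasRegIndependent k m)
  hasRegIndependent? k m =
    anySubset? (λ S → regIndependent? k S ×-dec (∣ S ∣ ≟ m))

open Graph

Forest : Graph → Set
Forest G = ∀ v vs → ¬ IsCycle G v vs

-- The default value 0 of max is harmless: the empty set is always k-independent
-- (see α-reg-attained and α-reg-upper).
α[_]-reg : ℕ → Graph → ℕ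
α[ k ]-reg G = max 0 (filter (hasRegIndependent? G k) (upTo (suc (order G))))

α-reg : Graph → ℕ
α-reg = α[ 0 ]-reg

α-reg-attained : ∀ k G → ∃[ S ] RegIndependent G k S × ∣ S ∣ ≡ α[ k ]-reg G
α-reg-attained k G =
  argmax-all id {P = HasRegIndependent G k}
    (⊥ , ((λ _ v∈⊥ → contradiction v∈⊥ ∉⊥)
         , (λ _ _ u∈⊥ _ → contradiction u∈⊥ ∉⊥))
       , ∣⊥∣≡0 (order G))
    (all-filter (hasRegIndependent? G k) (upTo (suc (order G))))

α-reg-upper : ∀ k G S → RegIndependent G k S → ∣ S ∣ ≤ α[ k ]-reg G
α-reg-upper k G S ind =
  lookup (xs≤max 0 _)
    (∈-filter⁺ (hasRegIndependent? G k) (∈-upTo⁺ (s≤s (∣p∣≤n S)))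
      (S , ind , refl))

infix 4 _≅_
_≅_ : Graph → Graph → Set
G ≅ H = Σ (Vertex G ↔ Vertex H) λ f →
  ∀ u v → (_~_ G u v) ⇔ (_~_ H (Inverse.to f u) (Inverse.to f v))

-- Infinitely many means infinitely many up to isomorphism.
InfinitelyManyForests : (Graph → Set) → Set₁
InfinitelyManyForests P = Σ (ℕ → Graph) λ F →
  (∀ i → Forest (F i) × P (F i)) × (∀ i j → F i ≅ F j → i ≡ j)

{-# OPTIONS --safe #-}
module Submission where

-- Let U be the set of vertices outside the K₁ and K₂ components, with l leaves and
-- n₂ vertices of degree two. If U is nonempty, it induces fewer edges than it has
-- vertices, and summing degrees gives |U| + 2 ≤ 2 l + n₂. The isolated vertices, the
-- leaves of U with half of the K₂'s, and a large part of the degree-two class are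
-- regular k-independent: for k = 0 a proper 2-colouring gives half of that class, for
-- k = 1 a 3-colouring with distinct colours at distance ≤ 2 gives two thirds, and for
-- k ≥ 2 the whole class qualifies. For equality take forests of maximum degree 3 with
-- balanced degree classes, where the vertices of degree two induce paths of order 2
-- when k = 0 (4 in the smallest one) and of order 3 when k = 1.

open import Defs
open import Data.Bool.Base using (Bool; true; false; not; if_then_else_)
import Data.Bool.Properties as Bool
open import Data.Empty using (⊥; ⊥-elim)
open import Data.Fin.Base as Fin using (Fin; zero; suc; _↑ʳ_)
open import Data.Fin.Patterns using (0F; 1F; 2F; 3F; 4F; 5F; 6F; 7F; 8F)
open import Data.Fin.Induction using (<-wellFounded)
open import Data.Fin.Properties using (_≟_; any?; suc-injective; all?; <-cmp; ↑ʳ-injective)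
open import Data.Fin.Subset using (Subset; ∣_∣) renaming (_∈_ to _∈ₛ_)
open import Data.Fin.Subset.Properties using (x∈p∩q⁺; x∈p∩q⁻; nonempty?)
open import Data.List.Base
  using (List; []; _∷_; [_]; _++_; length; filter; map; take; allFin; fromMaybe)
open import Data.List.Membership.Propositional using (_∈_; _∉_; find; lose)
open import Data.List.Membership.Propositional.Properties
  using (∈-filter⁺; ∈-filter⁻; ∈-allFin; ∈-map⁺; ∈-map⁻; ∈-++⁻)
open import Data.List.Properties
  using (filter-notAll; length-map; length-tabulate; length-++; filter-none; map-cong-local)
open import Data.List.Relation.Unary.All as All using (All; []; _∷_)
import Data.List.Relation.Unary.All.Properties as All
open import Data.List.Relation.Unary.AllPairs using ([]; _∷_)
open import Data.List.Relation.Unary.Any as Any using (Any; here; there)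
open import Data.List.Relation.Unary.Linked using (Linked; [-]; _∷_)
open import Data.List.Relation.Unary.Unique.Propositional using (Unique)
import Data.List.Relation.Unary.Unique.Propositional.Properties as Unique
open import Data.Maybe.Base using (Maybe; just; nothing)
open import Data.Maybe.Properties using (≡-dec)
open import Data.Nat.Base using (ℕ; zero; suc; _+_; _*_; NonZero; z≤n; s≤s; s≤s⁻¹)
  renaming (_≤_ to _≤ℕ_)
open import Data.Nat.ListAction using (sum)
open import Data.Nat.Properties as ℕ using (≤-refl; ≤-trans; ≤-reflexive; +-mono-≤; *-monoʳ-≤)
open import Data.Nat.Tactic.RingSolver using (solve-∀)
open import Data.Product.Base using (∃; ∃-syntax; ∃₂; _×_; _,_; proj₁; proj₂)
open import Data.Sum.Base using (_⊎_; inj₁; inj₂; [_,_]′)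
open import Data.Vec.Base as Vec using ([]; _∷_; here; there)
open import Data.Vec.Properties using ([]=⇒lookup; lookup⇒[]=; lookup∘tabulate)
open import Function.Base using (_∘_; id)
open import Induction.WellFounded using (Acc; acc)
open import Level using (0ℓ)
open import Relation.Binary.Definitions using (DecidableEquality; tri<; tri≈; tri>)
open import Relation.Binary.PropositionalEquality
  using (_≡_; _≢_; refl; sym; trans; cong; cong₂; subst; subst₂; module ≡-Reasoning)
open import Relation.Nullary.Decidable
  using (Dec; yes; no; does; ¬?; _×-dec_; dec-true; dec-false; decidable-stable; from-yes)
open import Relation.Nullary.Negation using (¬_; contradiction)
open import Relation.Unary using (Pred; Decidable)
open import Algebra.Properties.CommutativeSemigroup ℕ.+-commutativeSemigroup using (x∙yz≈y∙xz)
open import Data.Fin.Permutation using (↔⇒≡)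
import Data.Integer.Base as ℤ
open import Data.Integer.Properties using (pos-*)
import Data.Rational.Properties as ℚ
open import Data.Rational.Unnormalised.Base using (mkℚᵘ; *≤*; *≡*)
import Data.Rational.Unnormalised.Properties as ℚᵘ

-- Counting in lists and subsets

-- Write i for the number of isolated vertices, p for the number of vertices in K₂ components and a
-- for the regular k-independence number. Adding the components outside U gives n + 2 ≤ i + (2 l +
-- p) + n₂, where i ≤ a, 2 l + p ≤ 2 a, and n₂ is at most 2 a, 3 a / 2 or a for k = 0, k = 1 or k ≥
-- 2; the totals are 5 a, 9 a / 2 and 4 a. The K₂ components are set apart because their two leaves
-- are adjacent: they enter with weight 1 per vertex, whereas a leaf of U has weight 2. If U is
-- empty, the summand 2 cannot come from the degree sum and is paid for by a ≥ 1. In the lower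
-- bounds acyclicity enters only through an order in which every vertex has at most one neighbour
-- among the later ones; the edge count and both colourings are inductions along it.

unique⊆⇒length≤ : ∀ {A : Set} → DecidableEquality A → {xs ys : List A} →
                  Unique xs → (∀ {x} → x ∈ xs → x ∈ ys) → length xs ≤ℕ length ys
unique⊆⇒length≤ _≟′_ [] _ = z≤n
unique⊆⇒length≤ _≟′_ {x ∷ xs} {ys} (x∉xs ∷ xs!) xs⊆ys =
  ≤-trans (s≤s (unique⊆⇒length≤ _≟′_ xs! xs⊆ys∖x))
          (filter-notAll (λ y → ¬? (x ≟′ y)) ys
            (Any.map (λ x≡y x≢y → x≢y x≡y) (xs⊆ys (here refl))))
  where
  xs⊆ys∖x : ∀ {y} → y ∈ xs → y ∈ filter (λ z → ¬? (x ≟′ z)) ys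
  xs⊆ys∖x y∈xs =
    ∈-filter⁺ (λ z → ¬? (x ≟′ z)) (xs⊆ys (there y∈xs)) (All.lookup x∉xs y∈xs)

length-filter-∁ : ∀ {A : Set} {P : Pred A 0ℓ} (P? : Decidable P) (xs : List A) →
  length (filter P? xs) + length (filter (λ x → ¬? (P? x)) xs) ≡ length xs
length-filter-∁ P? [] = refl
length-filter-∁ P? (x ∷ xs) with P? x
... | yes _ = cong suc (length-filter-∁ P? xs)
... | no  _ = trans (ℕ.+-suc _ _) (cong suc (length-filter-∁ P? xs))

length-constant≤1 : ∀ {A : Set} {xs : List A} → Unique xs →
                    (∀ {x y} → x ∈ xs → y ∈ xs → x ≡ y) → length xs ≤ℕ 1
length-constant≤1 [] _ = z≤n
length-constant≤1 (_ ∷ []) _ = s≤s z≤n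
length-constant≤1 ((x≢y ∷ _) ∷ _ ∷ _) same =
  contradiction (same (here refl) (there (here refl))) x≢y

elements : ∀ {n} → Subset n → List (Fin n)
elements []          = []
elements (true ∷ p)  = zero ∷ map suc (elements p)
elements (false ∷ p) = map suc (elements p)

length-elements : ∀ {n} (p : Subset n) → length (elements p) ≡ ∣ p ∣
length-elements []          = refl
length-elements (true ∷ p)  = cong suc (trans (length-map suc (elements p)) (length-elements p))
length-elements (false ∷ p) = trans (length-map suc (elements p)) (length-elements p)

∈-elements⁺ : ∀ {n} {p : Subset n} {x} → x ∈ₛ p → x ∈ elements p
∈-elements⁺ here = here refl
∈-elements⁺ {p = true ∷ _}  (there x∈p) = there (∈-map⁺ suc (∈-elements⁺ x∈p))
∈-elements⁺ {p = false ∷ _} (there x∈p) = ∈-map⁺ suc (∈-elements⁺ x∈p)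

∈-elements⁻ : ∀ {n} {p : Subset n} {x} → x ∈ elements p → x ∈ₛ p
∈-elements⁻ {p = true ∷ _} (here refl) = here
∈-elements⁻ {p = true ∷ _} (there x∈) with ∈-map⁻ suc x∈
... | _ , y∈ , refl = there (∈-elements⁻ y∈)
∈-elements⁻ {p = false ∷ _} x∈ with ∈-map⁻ suc x∈
... | _ , y∈ , refl = there (∈-elements⁻ y∈)

elements-unique : ∀ {n} (p : Subset n) → Unique (elements p)
elements-unique [] = []
elements-unique (true ∷ p) =
  All.tabulate (λ 0∈ 0≡ → case-suc 0≡ (∈-map⁻ suc 0∈))
    ∷ Unique.map⁺ suc-injective (elements-unique p)
  where
  case-suc : ∀ {x} → zero ≡ x → (∃ λ y → y ∈ elements p × x ≡ suc y) → _
  case-suc refl (_ , _ , ())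
elements-unique (false ∷ p) = Unique.map⁺ suc-injective (elements-unique p)

∣p∣≤length : ∀ {n} {p : Subset n} {xs} → (∀ {x} → x ∈ₛ p → x ∈ xs) → ∣ p ∣ ≤ℕ length xs
∣p∣≤length {p = p} p⊆xs = subst (_≤ℕ _) (length-elements p)
  (unique⊆⇒length≤ _≟_ (elements-unique p) (p⊆xs ∘ ∈-elements⁻))

length≤∣p∣ : ∀ {n} {p : Subset n} {xs} → Unique xs → (∀ {x} → x ∈ xs → x ∈ₛ p) → length xs ≤ℕ ∣ p ∣
length≤∣p∣ {p = p} xs! xs⊆p = subst (_ ≤ℕ_) (length-elements p)
  (unique⊆⇒length≤ _≟_ xs! (∈-elements⁺ ∘ xs⊆p))

∈-comprehension⁺ : ∀ {n} {P : Pred (Fin n) 0ℓ} (P? : Decidable P) {x} →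
                   P x → x ∈ₛ Vec.tabulate (does ∘ P?)
∈-comprehension⁺ P? {x} px =
  lookup⇒[]= x _ (trans (lookup∘tabulate _ x) (dec-true (P? x) px))

∈-comprehension⁻ : ∀ {n} {P : Pred (Fin n) 0ℓ} (P? : Decidable P) {x} →
                   x ∈ₛ Vec.tabulate (does ∘ P?) → P x
∈-comprehension⁻ P? {x} x∈
  with P? x | trans (sym (lookup∘tabulate (does ∘ P?) x)) ([]=⇒lookup x∈)
... | yes px | _ = px
... | no _   | ()

-- Term by term, `f x` ≥ 1 gives 3 ≤ `f x` + 2 [`f x` = 1] + [`f x` = 2].
3*length≤sum : ∀ {A : Set} (f : A → ℕ) {xs : List A} → All (λ x → 1 ≤ℕ f x) xs →
  3 * length xs ≤ℕ sum (map f xs) + (2 * length (filter (λ x → f x ℕ.≟ 1) xs)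
                                    + length (filter (λ x → f x ℕ.≟ 2) xs))
3*length≤sum f [] = z≤n
3*length≤sum f {x ∷ xs} (1≤ ∷ 1≤s) with f x | 3*length≤sum f 1≤s
... | suc zero | ih = begin
  3 * suc (length xs)       ≡⟨ ℕ.*-suc 3 (length xs) ⟩
  3 + 3 * length xs         ≤⟨ ℕ.+-monoʳ-≤ 3 ih ⟩
  3 + (s + (2 * l₁ + l₂))   ≡⟨ lem s l₁ l₂ ⟩
  1 + s + (2 * suc l₁ + l₂) ∎
  where
  open ℕ.≤-Reasoning
  s  = sum (map f xs)
  l₁ = length (filter (λ x → f x ℕ.≟ 1) xs)
  l₂ = length (filter (λ x → f x ℕ.≟ 2) xs)
  lem : ∀ s l m → 3 + (s + (2 * l + m)) ≡ 1 + s + (2 * suc l + m)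
  lem = solve-∀
... | suc (suc zero) | ih = begin
  3 * suc (length xs)       ≡⟨ ℕ.*-suc 3 (length xs) ⟩
  3 + 3 * length xs         ≤⟨ ℕ.+-monoʳ-≤ 3 ih ⟩
  3 + (s + (2 * l₁ + l₂))   ≡⟨ lem s l₁ l₂ ⟩
  2 + s + (2 * l₁ + suc l₂) ∎
  where
  open ℕ.≤-Reasoning
  s  = sum (map f xs)
  l₁ = length (filter (λ x → f x ℕ.≟ 1) xs)
  l₂ = length (filter (λ x → f x ℕ.≟ 2) xs)
  lem : ∀ s l m → 3 + (s + (2 * l + m)) ≡ 2 + s + (2 * l + suc m)
  lem = solve-∀
... | suc (suc (suc k)) | ih = begin
  3 * suc (length xs)       ≡⟨ ℕ.*-suc 3 (length xs) ⟩
  3 + 3 * length xs         ≤⟨ ℕ.+-monoʳ-≤ 3 ih ⟩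
  3 + (s + t)               ≤⟨ ℕ.m≤m+n _ k ⟩
  3 + (s + t) + k           ≡⟨ lem s t k ⟩
  suc (suc (suc k)) + s + t ∎
  where
  open ℕ.≤-Reasoning
  s  = sum (map f xs)
  t  = 2 * length (filter (λ x → f x ℕ.≟ 1) xs) + length (filter (λ x → f x ℕ.≟ 2) xs)
  lem : ∀ s t k → 3 + (s + t) + k ≡ suc (suc (suc k)) + s + t
  lem = solve-∀

-- Degrees and regular sets, by lists of vertices

module _ (G : Graph) where
  open Graph G
  open import Data.List.Membership.DecPropositional (_≟_ {order}) using (_∈?_)

  neighboursIn : List Vertex → Vertex → List Vertex
  neighboursIn xs v = filter (v ~?_) xs

  ≤degree : ∀ {v xs} → Unique xs → (∀ {x} → x ∈ xs → v ~ x) → length xs ≤ℕ degree v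
  ≤degree {v} xs! v~xs = length≤∣p∣ xs! (∈-comprehension⁺ (v ~?_) ∘ v~xs)

  length-neighboursIn≤degree : ∀ v {xs} → Unique xs → length (neighboursIn xs v) ≤ℕ degree v
  length-neighboursIn≤degree v {xs} xs! =
    ≤degree (Unique.filter⁺ (v ~?_) xs!) (λ x∈ → proj₂ (∈-filter⁻ (v ~?_) {xs = xs} x∈))

  degree≡length-neighboursIn : ∀ v {xs} → Unique xs → (∀ {x} → v ~ x → x ∈ xs) →
                               degree v ≡ length (neighboursIn xs v)
  degree≡length-neighboursIn v {xs} xs! N⊆xs = ℕ.≤-antisym
    (∣p∣≤length (λ x∈N → let v~x = ∈-comprehension⁻ (v ~?_) x∈N in
                         ∈-filter⁺ (v ~?_) (N⊆xs v~x) v~x))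
    (length-neighboursIn≤degree v xs!)

  degree≤1⇒neighbours≡ : ∀ {v x y} → degree v ≤ℕ 1 → v ~ x → v ~ y → x ≡ y
  degree≤1⇒neighbours≡ {v} {x} {y} d≤1 v~x v~y with x ≟ y
  ... | yes x≡y = x≡y
  ... | no  x≢y = contradiction
    (≤-trans (≤degree {xs = x ∷ y ∷ []} ((x≢y ∷ []) ∷ [] ∷ [])
                (λ { (here refl) → v~x ; (there (here refl)) → v~y })) d≤1)
    λ { (s≤s ()) }

  length≤α : ∀ k {xs} → Unique xs →
             (∀ {u v} → u ∈ xs → v ∈ xs → degree u ≡ degree v) →
             (∀ {v} → v ∈ xs → length (neighboursIn xs v) ≤ℕ k) →
             length xs ≤ℕ α[ k ]-reg G
  length≤α k {xs} xs! equal independent =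
    ≤-trans (length≤∣p∣ xs! (∈-comprehension⁺ (_∈? xs)))
            (α-reg-upper k G S (S-independent , λ u v u∈S v∈S → equal (⇒xs u∈S) (⇒xs v∈S)))
    where
    S : Subset order
    S = Vec.tabulate (does ∘ (_∈? xs))
    ⇒xs : ∀ {x} → x ∈ₛ S → x ∈ xs
    ⇒xs = ∈-comprehension⁻ (_∈? xs)
    S-independent : Independent k S
    S-independent v v∈S = ≤-trans
      (∣p∣≤length (λ x∈ → let x∈N , x∈S = x∈p∩q⁻ (neighbours v) S x∈ in
        ∈-filter⁺ (v ~?_) (⇒xs x∈S) (∈-comprehension⁻ (v ~?_) x∈N)))
      (independent (⇒xs v∈S))

  -- A degree inside a set never exceeds the degree in the graph, so a class of degree at most `k`
  -- is `k`-independent as a whole.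
  length≤α-degree : ∀ {d k xs} → d ≤ℕ k → Unique xs → (∀ {v} → v ∈ xs → degree v ≡ d) →
                    length xs ≤ℕ α[ k ]-reg G
  length≤α-degree d≤k xs! deg≡d = length≤α _ xs!
    (λ u∈ v∈ → trans (deg≡d u∈) (sym (deg≡d v∈)))
    (λ v∈ → ≤-trans (length-neighboursIn≤degree _ xs!) (≤-trans (≤-reflexive (deg≡d v∈)) d≤k))

  -- Elimination orders

  AtMostOneNeighbour : List Vertex → Vertex → Set
  AtMostOneNeighbour xs v = ∀ {x y} → x ∈ xs → y ∈ xs → v ~ x → v ~ y → x ≡ y

  TwoNeighbours : List Vertex → Vertex → Set
  TwoNeighbours xs v = ∃₂ λ x y → x ∈ xs × y ∈ xs × v ~ x × v ~ y × x ≢ y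

  -- An elimination order witnessing 1-degeneracy. Read from its end, it builds the induced forest
  -- by adding isolated vertices and leaves.
  data Peelable : List Vertex → Set where
    []   : Peelable []
    peel : ∀ {v xs} → v ∉ xs → AtMostOneNeighbour xs v → Peelable xs → Peelable (v ∷ xs)

  twoNeighbours⊎atMostOne : ∀ xs v → TwoNeighbours xs v ⊎ AtMostOneNeighbour xs v
  twoNeighbours⊎atMostOne [] v = inj₂ λ ()
  twoNeighbours⊎atMostOne (x ∷ xs) v with v ~? x
  ... | no v≁x with twoNeighbours⊎atMostOne xs v
  ...   | inj₁ (y , z , y∈ , z∈ , rest) = inj₁ (y , z , there y∈ , there z∈ , rest)
  ...   | inj₂ unique = inj₂ λ where
            (here refl) _           v~x _   → contradiction v~x v≁x
            (there _)   (here refl) _   v~x → contradiction v~x v≁x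
            (there y∈)  (there z∈)  v~y v~z → unique y∈ z∈ v~y v~z
  twoNeighbours⊎atMostOne (x ∷ xs) v | yes v~x
    with Any.any? (λ y → (v ~? y) ×-dec ¬? (x ≟ y)) xs
  ... | yes p with find p
  ...   | y , y∈ , v~y , x≢y = inj₁ (x , y , here refl , there y∈ , v~x , v~y , x≢y)
  twoNeighbours⊎atMostOne (x ∷ xs) v | yes v~x | no none =
    inj₂ λ y∈ z∈ v~y v~z → trans (sym (x≡ y∈ v~y)) (x≡ z∈ v~z)
    where
    x≡ : ∀ {y} → y ∈ x ∷ xs → v ~ y → x ≡ y
    x≡ (here y≡x) _ = sym y≡x
    x≡ {y} (there y∈) v~y with x ≟ y
    ... | yes x≡y = x≡y
    ... | no  x≢y = contradiction (lose y∈ (v~y , x≢y)) none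

  -- The path is cut right after `u`. Writing the cut as a `take` lets the resulting cycle inherit
  -- distinct vertices by `Unique.take⁺`.
  close-path : ∀ {a u w xs} → Linked _~_ (a ∷ xs) → u ∈ xs → u ~ w →
    ∃[ k ] 1 ≤ℕ length (take (suc k) xs) × Linked _~_ (a ∷ take (suc k) xs ++ [ w ])
  close-path (a~x ∷ _) (here refl) u~w = 0 , s≤s z≤n , a~x ∷ u~w ∷ [-]
  close-path (a~x ∷ path@(_ ∷ _)) (there u∈) u~w with close-path path u∈ u~w
  ... | k , _ , path′ = suc k , s≤s z≤n , a~x ∷ path′

  peelable⇒unique : ∀ {xs} → Peelable xs → Unique xs
  peelable⇒unique [] = []
  peelable⇒unique (peel v∉xs _ pxs) =
    All.¬Any⇒All¬ _ v∉xs ∷ peelable⇒unique pxs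

  -- Deleting vertices only removes neighbours, so a single order of the whole forest serves every
  -- vertex class below.
  peelable-filter : ∀ {P : Pred Vertex 0ℓ} (P? : Decidable P) {xs} →
                    Peelable xs → Peelable (filter P? xs)
  peelable-filter P? [] = []
  peelable-filter P? {v ∷ xs} (peel v∉xs one pxs) with P? v
  ... | no  _ = peelable-filter P? pxs
  ... | yes _ = peel (v∉xs ∘ ⊆xs) (λ x∈ y∈ → one (⊆xs x∈) (⊆xs y∈)) (peelable-filter P? pxs)
    where
    ⊆xs : ∀ {x} → x ∈ filter P? xs → x ∈ xs
    ⊆xs x∈ = proj₁ (∈-filter⁻ P? x∈)

  module _ (forest : Forest G) where

    -- Of two distinct neighbours at least one differs from the predecessor, which is the only entry
    -- of `take 1 path`.
    extend : ∀ {a xs} → TwoNeighbours xs a → ∀ path →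
             ∃[ u ] u ∈ xs × a ~ u × u ∉ take 1 path
    extend (x , _ , x∈ , _ , a~x , _) [] = x , x∈ , a~x , λ ()
    extend (x , y , x∈ , y∈ , a~x , a~y , x≢y) (b ∷ _) with x ≟ b
    ... | no  x≢b  = x , x∈ , a~x , λ { (here x≡b) → x≢b x≡b }
    ... | yes refl = y , y∈ , a~y , λ { (here y≡x) → x≢y (sym y≡x) }

    -- A path that can be extended at its head without turning back either
    -- grows forever or closes up to a cycle.
    ¬all-twoNeighbours : ∀ {xs} → All (TwoNeighbours xs) xs →
      ∀ m {a path} → Unique (a ∷ path) → Linked _~_ (a ∷ path) → All (_∈ xs) (a ∷ path) →
      ¬ length xs ≤ℕ m + length path
    ¬all-twoNeighbours two zero path! _ path⊆xs xs≤ =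
      ℕ.<-irrefl refl (≤-trans (unique⊆⇒length≤ _≟_ path! (All.lookup path⊆xs)) xs≤)
    ¬all-twoNeighbours {xs} two (suc m) {a} {path} path! linked path⊆xs xs≤
      with extend (All.lookup two (All.head path⊆xs)) path
    ... | u , u∈xs , a~u , u∉₁ with u ∈? path
    ...   | no u∉path = ¬all-twoNeighbours two m
              (((λ { refl → ~-irrefl refl a~u }) ∷ All.¬Any⇒All¬ _ u∉path) ∷ path!)
              (~-sym a~u ∷ linked) (u∈xs ∷ path⊆xs)
              (subst (length xs ≤ℕ_) (sym (ℕ.+-suc m (length path))) xs≤)
    ...   | yes (here refl) = u∉₁ (here refl)
    ...   | yes (there u∈) with linked
    ...     | a~b ∷ linked′ with close-path linked′ u∈ (~-sym a~u)
    ...       | k , long , linked″ =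
                forest a _ (s≤s long , Unique.take⁺ (3 + k) path! , a~b ∷ linked″)

    some-atMostOne : ∀ {x xs} → Any (AtMostOneNeighbour (x ∷ xs)) (x ∷ xs)
    some-atMostOne {x} {xs} with All.decide (twoNeighbours⊎atMostOne (x ∷ xs)) (x ∷ xs)
    ... | inj₂ some = some
    -- The path starts as the single vertex `x`; the fuel is the number of vertices, so the length
    -- condition holds with an empty tail.
    ... | inj₁ two = contradiction (ℕ.m≤m+n _ 0)
      (¬all-twoNeighbours two (suc (length xs)) ([] ∷ []) [-] (here refl ∷ []))

    -- Some vertex has at most one neighbour among the remaining ones; it goes first, and removing
    -- all its copies shortens the list. The bound `m` makes the recursion structural.
    elimination-order : ∀ m {xs} → length xs ≤ℕ m →
      ∃[ ys ] Peelable ys × (∀ {x} → x ∈ ys → x ∈ xs) × (∀ {x} → x ∈ xs → x ∈ ys)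
    elimination-order _ {[]} _ = [] , [] , id , id
    elimination-order (suc m) {xs@(_ ∷ _)} xs≤ with find some-atMostOne
    ... | v , v∈ , one with elimination-order m {filter (λ x → ¬? (v ≟ x)) xs}
            (s≤s⁻¹ (≤-trans (filter-notAll (λ x → ¬? (v ≟ x)) xs (Any.map (λ v≡x v≢x → v≢x v≡x) v∈)) xs≤))
    ...   | ys , pys , ys⊆ , ⊆ys =
            v ∷ ys
          , peel (λ v∈ys → proj₂ (∈-filter⁻ ≢v? (ys⊆ v∈ys)) refl)
                 (λ x∈ y∈ → one (ys⊆xs x∈) (ys⊆xs y∈)) pys
          , (λ { (here refl) → v∈ ; (there x∈) → ys⊆xs x∈ })
          , xs⊆
      where
      ≢v? : Decidable (λ x → ¬ v ≡ x)
      ≢v? x = ¬? (v ≟ x)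
      ys⊆xs : ∀ {x} → x ∈ ys → x ∈ xs
      ys⊆xs = proj₁ ∘ ∈-filter⁻ ≢v? ∘ ys⊆
      xs⊆ : ∀ {x} → x ∈ xs → x ∈ v ∷ ys
      xs⊆ {x} x∈ with v ≟ x
      ... | yes refl = here refl
      ... | no  v≢x  = there (⊆ys (∈-filter⁺ ≢v? x∈ v≢x))

  -- Edges of an induced forest

  degreeSum : List Vertex → List Vertex → ℕ
  degreeSum xs ys = sum (map (length ∘ neighboursIn xs) ys)

  -- Double counting with symmetric adjacency: inserting `v` into the first list adds 1 at each
  -- neighbour of `v` in `ys`. The two lists are separate arguments so that they can grow one at a
  -- time.
  degreeSum-∷ : ∀ v xs ys →
    degreeSum (v ∷ xs) ys ≡ length (neighboursIn ys v) + degreeSum xs ys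
  degreeSum-∷ v xs [] = refl
  degreeSum-∷ v xs (y ∷ ys) with v ~? y | y ~? v | degreeSum-∷ v xs ys
  ... | yes _   | yes _   | ih = cong suc (trans (cong (length (neighboursIn xs y) +_) ih)
    (x∙yz≈y∙xz (length (neighboursIn xs y)) (length (neighboursIn ys v)) (degreeSum xs ys)))
  ... | no  _   | no  _   | ih = trans (cong (length (neighboursIn xs y) +_) ih)
    (x∙yz≈y∙xz (length (neighboursIn xs y)) (length (neighboursIn ys v)) (degreeSum xs ys))
  ... | yes v~y | no  y≁v | _ = contradiction (~-sym v~y) y≁v
  ... | no  v≁y | yes y~v | _ = contradiction (~-sym y~v) v≁y

  length-neighboursIn-∷ : ∀ v xs → length (neighboursIn (v ∷ xs) v) ≡ length (neighboursIn xs v)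
  length-neighboursIn-∷ v xs with v ~? v
  ... | yes v~v = contradiction v~v (~-irrefl refl)
  ... | no  _   = refl

  atMostOne⇒length≤1 : ∀ {v xs} → Unique xs → AtMostOneNeighbour xs v →
                       length (neighboursIn xs v) ≤ℕ 1
  atMostOne⇒length≤1 {v} {xs} xs! one = length-constant≤1 (Unique.filter⁺ (v ~?_) xs!) λ x∈ y∈ →
    let x∈xs , v~x = ∈-filter⁻ (v ~?_) {xs = xs} x∈
        y∈xs , v~y = ∈-filter⁻ (v ~?_) {xs = xs} y∈
    in one x∈xs y∈xs v~x v~y

  -- A vertex put back at the head brings at most one edge, which raises the degree sum by at most
  -- 2. The last vertex of the order brings none; this is the origin of the summand 2.
  peelable⇒degreeSum≤ : ∀ {v xs} → Peelable (v ∷ xs) →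
    degreeSum (v ∷ xs) (v ∷ xs) + 2 ≤ℕ 2 * length (v ∷ xs)
  peelable⇒degreeSum≤ {v} {[]} _ =
    ≤-reflexive (cong (λ d → d + 0 + 2) (length-neighboursIn-∷ v []))
  peelable⇒degreeSum≤ {v} {xs@(_ ∷ _)} (peel _ one pxs) = begin
    length (neighboursIn (v ∷ xs) v) + degreeSum (v ∷ xs) xs + 2
      ≡⟨ cong₂ (λ a b → a + b + 2) (length-neighboursIn-∷ v xs) (degreeSum-∷ v xs xs) ⟩
    d + (d + degreeSum xs xs) + 2
      ≡⟨ lem d (degreeSum xs xs) ⟩
    2 * d + (degreeSum xs xs + 2)
      ≤⟨ +-mono-≤ (*-monoʳ-≤ 2 (atMostOne⇒length≤1 (peelable⇒unique pxs) one))
                  (peelable⇒degreeSum≤ pxs) ⟩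
    2 + 2 * length xs
      ≡⟨ ℕ.*-suc 2 (length xs) ⟨
    2 * length (v ∷ xs) ∎
    where
    open ℕ.≤-Reasoning
    d = length (neighboursIn xs v)
    lem : ∀ a b → a + (a + b) + 2 ≡ 2 * a + (b + 2)
    lem = solve-∀

  -- Colourings

  recolour : ∀ {C : Set} → (Vertex → C) → Vertex → C → Vertex → C
  recolour c v b x = if does (x ≟ v) then b else c x

  recolour-≡ : ∀ {C : Set} (c : Vertex → C) v b → recolour c v b v ≡ b
  recolour-≡ c v b = cong (λ t → if t then b else c v) (dec-true (v ≟ v) refl)

  recolour-∈ : ∀ {C : Set} (c : Vertex → C) {v} b {x xs} → v ∉ xs → x ∈ xs →
               recolour c v b x ≡ c x
  recolour-∈ c {v} b {x} v∉xs x∈xs =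
    cong (λ t → if t then b else c x) (dec-false (x ≟ v) λ { refl → v∉xs x∈xs })

  Proper : ∀ {C : Set} → List Vertex → (Vertex → C) → Set
  Proper xs c = ∀ {u v} → u ∈ xs → v ∈ xs → u ~ v → c u ≢ c v

  -- Together with `Proper` this describes a proper colouring of the square of the induced subgraph.
  NeighboursDistinct : ∀ {C : Set} → List Vertex → (Vertex → C) → Set
  NeighboursDistinct xs c = ∀ {v x y} → v ∈ xs → x ∈ xs → y ∈ xs →
                            v ~ x → v ~ y → x ≢ y → c x ≢ c y

  proper-∷ : ∀ {C : Set} {c : Vertex → C} {v b xs} → v ∉ xs → Proper xs c →
             (∀ {x} → x ∈ xs → v ~ x → b ≢ c x) → Proper (v ∷ xs) (recolour c v b)
  proper-∷ _ _ _ (here refl) (here refl) v~v _ = ~-irrefl refl v~v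
  proper-∷ {c = c} {v} {b} v∉ _ new (here refl) (there y∈) v~y eq = new y∈ v~y
    (trans (sym (recolour-≡ c v b)) (trans eq (recolour-∈ c b v∉ y∈)))
  proper-∷ {c = c} {v} {b} v∉ _ new (there x∈) (here refl) x~v eq = new x∈ (~-sym x~v)
    (trans (sym (recolour-≡ c v b)) (trans (sym eq) (recolour-∈ c b v∉ x∈)))
  proper-∷ {c = c} {v} {b} v∉ old _ (there x∈) (there y∈) x~y eq = old x∈ y∈ x~y
    (trans (sym (recolour-∈ c b v∉ x∈)) (trans eq (recolour-∈ c b v∉ y∈)))

  two-colouring : ∀ {xs} → Peelable xs → ∃ λ (c : Vertex → Bool) → Proper xs c
  two-colouring [] = (λ _ → true) , λ ()
  two-colouring {v ∷ xs} (peel v∉ one pxs) with two-colouring pxs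
  ... | c , proper with Any.any? (v ~?_) xs
  ...   | no none = recolour c v true , proper-∷ v∉ proper λ x∈ v~x _ → none (lose x∈ v~x)
  ...   | yes some with find some
  ...     | u , u∈ , v~u = recolour c v (not (c u)) , proper-∷ v∉ proper λ x∈ v~x eq →
              Bool.not-¬ (cong c (one x∈ u∈ v~x v~u)) (sym eq)

  half-independent : ∀ {xs} → Peelable xs → ∃[ ys ] Unique ys × (∀ {x} → x ∈ ys → x ∈ xs) ×
    (∀ {x y} → x ∈ ys → y ∈ ys → ¬ x ~ y) × length xs ≤ℕ 2 * length ys
  half-independent {xs} pxs with two-colouring pxs
  ... | c , proper with ℕ.≤-total (length (filter (λ x → c x Bool.≟ true) xs))
                                  (length (filter (λ x → ¬? (c x Bool.≟ true)) xs))
  ...   | inj₁ le =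
          filter ≢true? xs
        , Unique.filter⁺ ≢true? (peelable⇒unique pxs)
        , proj₁ ∘ ∈-filter⁻ ≢true?
        , (λ x∈ y∈ x~y → let x∈xs , cx = ∈-filter⁻ ≢true? {xs = xs} x∈
                             y∈xs , cy = ∈-filter⁻ ≢true? {xs = xs} y∈
                         in proper x∈xs y∈xs x~y (trans (Bool.¬-not cx) (sym (Bool.¬-not cy))))
        , (begin
            length xs
              ≡⟨ length-filter-∁ (λ x → c x Bool.≟ true) xs ⟨
            length (filter (λ x → c x Bool.≟ true) xs) + length (filter ≢true? xs)
              ≤⟨ +-mono-≤ le (ℕ.m≤m+n _ 0) ⟩
            2 * length (filter ≢true? xs) ∎)
    where
    open ℕ.≤-Reasoning
    ≢true? : Decidable (λ x → ¬ c x ≡ true)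
    ≢true? x = ¬? (c x Bool.≟ true)
  ...   | inj₂ ge =
          filter ≡true? xs
        , Unique.filter⁺ ≡true? (peelable⇒unique pxs)
        , proj₁ ∘ ∈-filter⁻ ≡true?
        , (λ x∈ y∈ x~y → let x∈xs , cx = ∈-filter⁻ ≡true? {xs = xs} x∈
                             y∈xs , cy = ∈-filter⁻ ≡true? {xs = xs} y∈
                         in proper x∈xs y∈xs x~y (trans cx (sym cy)))
        , (begin
            length xs
              ≡⟨ length-filter-∁ ≡true? xs ⟨
            length (filter ≡true? xs) + length (filter (λ x → ¬? (≡true? x)) xs)
              ≤⟨ ℕ.+-monoʳ-≤ _ (≤-trans ge (ℕ.m≤m+n _ 0)) ⟩
            2 * length (filter ≡true? xs) ∎)
    where
    open ℕ.≤-Reasoning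
    ≡true? : Decidable (λ x → c x ≡ true)
    ≡true? x = c x Bool.≟ true

  third-colour? : Dec ((a b : Fin 3) → ∃ λ c → c ≢ a × c ≢ b)
  third-colour? = all? λ a → all? λ b → any? λ c → ¬? (c ≟ a) ×-dec ¬? (c ≟ b)

  degree≤2⇒¬three : ∀ {u x y z} → degree u ≤ℕ 2 → u ~ x → u ~ y → u ~ z →
                    x ≢ y → x ≢ z → ¬ y ≢ z
  degree≤2⇒¬three {x = x} {y} {z} d≤2 u~x u~y u~z x≢y x≢z y≢z = contradiction
    (≤-trans (≤degree {xs = x ∷ y ∷ z ∷ []}
                ((x≢y ∷ x≢z ∷ []) ∷ (y≢z ∷ []) ∷ [] ∷ [])
                (λ { (here refl) → u~x ; (there (here refl)) → u~y
                   ; (there (there (here refl))) → u~z })) d≤2)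
    λ { (s≤s (s≤s ())) }

  -- The only possible neighbour `u` of `v` in `xs` has degree at most 2, and `v` takes one of these
  -- places; so at most one further vertex `w` lies behind `u`. Only the colours of `u` and `w` are
  -- forbidden, and three colours suffice.
  fresh-colour : ∀ {v xs} (c : Vertex → Fin 3) → v ∉ xs → AtMostOneNeighbour xs v →
    (∀ {u} → u ∈ xs → degree u ≤ℕ 2) →
    ∃ λ b → (∀ {x} → x ∈ xs → v ~ x → b ≢ c x) ×
            (∀ {u x} → u ∈ xs → x ∈ xs → u ~ v → u ~ x → b ≢ c x)
  fresh-colour {v} {xs} c v∉ one d≤2 with Any.any? (v ~?_) xs
  ... | no none = zero
                , (λ x∈ v~x → contradiction (lose x∈ v~x) none)
                , (λ u∈ _ u~v → contradiction (lose u∈ (~-sym u~v)) none)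
  ... | yes some with find some
  ...   | u , u∈ , v~u with Any.any? (u ~?_) xs
  ...     | no none with from-yes third-colour? (c u) (c u)
  ...       | b , b≢cu , _ =
              b , (λ x∈ v~x b≡cx → b≢cu (trans b≡cx (cong c (one x∈ u∈ v~x v~u))))
                , (λ u′∈ x∈ u′~v u′~x → contradiction
                    (lose x∈ (subst (_~ _) (one u′∈ u∈ (~-sym u′~v) v~u) u′~x)) none)
  fresh-colour {v} {xs} c v∉ one d≤2 | yes some | u , u∈ , v~u | yes some′ with find some′
  ... | w , w∈ , u~w with from-yes third-colour? (c u) (c w)
  ...   | b , b≢cu , b≢cw =
          b , (λ x∈ v~x b≡cx → b≢cu (trans b≡cx (cong c (one x∈ u∈ v~x v~u))))
            , (λ u′∈ x∈ u′~v u′~x b≡cx → b≢cw (trans b≡cx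
                (cong c (x≡w x∈ (subst (_~ _) (one u′∈ u∈ (~-sym u′~v) v~u) u′~x)))))
    where
    v≢_ : ∀ {x} → x ∈ xs → v ≢ x
    (v≢ x∈) refl = v∉ x∈
    x≡w : ∀ {x} → x ∈ xs → u ~ x → x ≡ w
    x≡w {x} x∈ u~x with x ≟ w
    ... | yes x≡w = x≡w
    ... | no  x≢w = contradiction x≢w
      (degree≤2⇒¬three (d≤2 u∈) (~-sym v~u) u~x u~w (v≢ x∈) (v≢ w∈))

  three-colouring : ∀ {xs} → Peelable xs → (∀ {u} → u ∈ xs → degree u ≤ℕ 2) →
    ∃ λ (c : Vertex → Fin 3) → Proper xs c × NeighboursDistinct xs c
  three-colouring [] _ = (λ _ → zero) , (λ ()) , λ ()
  three-colouring {v ∷ xs} (peel v∉ one pxs) d≤2 with three-colouring pxs (d≤2 ∘ there)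
  ... | c , proper , distinct with fresh-colour c v∉ one (d≤2 ∘ there)
  ...   | b , new , new′ = c′ , proper-∷ v∉ proper new , distinct′
    where
    c′ = recolour c v b
    new″ : ∀ {u x} → u ∈ xs → x ∈ xs → u ~ v → u ~ x → c′ v ≢ c′ x
    new″ u∈ x∈ u~v u~x eq = new′ u∈ x∈ u~v u~x
      (trans (sym (recolour-≡ c v b)) (trans eq (recolour-∈ c b v∉ x∈)))
    -- A new pair at distance two has `v` as an end, where `new′` applies, or as its middle, which
    -- is impossible since `v` has at most one neighbour in `xs`.
    distinct′ : NeighboursDistinct (v ∷ xs) c′
    distinct′ _ (here refl) (here refl) _ _ x≢y = contradiction refl x≢y
    distinct′ (here refl) (here refl) _ v~v = contradiction v~v (~-irrefl refl)
    distinct′ (here refl) _ (here refl) _ v~v = contradiction v~v (~-irrefl refl)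
    distinct′ (here refl) (there x∈) (there y∈) v~x v~y x≢y =
      contradiction (one x∈ y∈ v~x v~y) x≢y
    distinct′ (there u∈) (here refl) (there y∈) u~v u~y _ = new″ u∈ y∈ u~v u~y
    distinct′ (there u∈) (there x∈) (here refl) u~x u~v _ = new″ u∈ x∈ u~v u~x ∘ sym
    distinct′ (there u∈) (there x∈) (there y∈) u~x u~y x≢y eq =
      distinct u∈ x∈ y∈ u~x u~y x≢y
        (trans (sym (recolour-∈ c b v∉ x∈)) (trans eq (recolour-∈ c b v∉ y∈)))

  -- Pigeonhole, decided by exhaustion: a vertex and two of its neighbours that all survive the
  -- deletion of colour `i` would need three distinct colours among the two left.
  ¬four-colours? : Dec ((i a b c : Fin 3) →
    ¬ (a ≢ i × b ≢ i × c ≢ i × a ≢ b × a ≢ c × b ≢ c))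
  ¬four-colours? = all? λ i → all? λ a → all? λ b → all? λ c →
    ¬? (¬? (a ≟ i) ×-dec ¬? (b ≟ i) ×-dec ¬? (c ≟ i)
        ×-dec ¬? (a ≟ b) ×-dec ¬? (a ≟ c) ×-dec ¬? (b ≟ c))

  -- Deleting one colour class leaves every vertex at most one neighbour.
  two-thirds-1-independent : ∀ {xs m} → Peelable xs → (∀ {u} → u ∈ xs → degree u ≤ℕ 2) →
    (∀ {ys} → Unique ys → (∀ {x} → x ∈ ys → x ∈ xs) →
      (∀ {v} → v ∈ ys → length (neighboursIn ys v) ≤ℕ 1) → length ys ≤ℕ m) →
    2 * length xs ≤ℕ 3 * m
  two-thirds-1-independent {xs} {m} pxs d≤2 bounded with three-colouring pxs d≤2
  ... | c , proper , distinct =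
    subst (_≤ℕ 3 * m) (length-classes xs)
      (+-mono-≤ (class≤ _) (+-mono-≤ (class≤ _) (+-mono-≤ (class≤ _) z≤n)))
    where
    ≢? : ∀ i → Decidable (λ x → ¬ c x ≡ i)
    ≢? i x = ¬? (c x ≟ i)
    xs! = peelable⇒unique pxs
    class≤ : ∀ i → length (filter (≢? i) xs) ≤ℕ m
    class≤ i = bounded (Unique.filter⁺ (≢? i) xs!) (proj₁ ∘ ∈-filter⁻ (≢? i)) λ {v} v∈ →
      atMostOne⇒length≤1 (Unique.filter⁺ (≢? i) xs!) λ {x} {y} x∈ y∈ v~x v~y →
        let v∈xs , cv = ∈-filter⁻ (≢? i) {xs = xs} v∈
            x∈xs , cx = ∈-filter⁻ (≢? i) {xs = xs} x∈
            y∈xs , cy = ∈-filter⁻ (≢? i) {xs = xs} y∈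
        in decidable-stable (x ≟ y) λ x≢y → from-yes ¬four-colours? i (c v) (c x) (c y)
             (cv , cx , cy , proper v∈xs x∈xs v~x , proper v∈xs y∈xs v~y
             , distinct v∈xs x∈xs y∈xs v~x v~y x≢y)
    size : Fin 3 → List Vertex → ℕ
    size i ys = length (filter (≢? i) ys)
    -- Each vertex is dropped from exactly one of the three lists and so is counted twice.
    length-classes : ∀ ys →
      size zero ys + (size (suc zero) ys + (size (suc (suc zero)) ys + 0)) ≡ 2 * length ys
    length-classes [] = refl
    length-classes (y ∷ ys) with c y | length-classes ys
    ... | zero           | ih =
      trans (lem (size zero ys) (size (suc zero) ys) (size (suc (suc zero)) ys))
      (trans (cong (2 +_) ih) (sym (ℕ.*-suc 2 (length ys))))
      where
      lem : ∀ p q r → p + (suc q + (suc r + 0)) ≡ 2 + (p + (q + (r + 0)))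
      lem = solve-∀
    ... | suc zero       | ih =
      trans (lem (size zero ys) (size (suc zero) ys) (size (suc (suc zero)) ys))
      (trans (cong (2 +_) ih) (sym (ℕ.*-suc 2 (length ys))))
      where
      lem : ∀ p q r → suc p + (q + (suc r + 0)) ≡ 2 + (p + (q + (r + 0)))
      lem = solve-∀
    ... | suc (suc zero) | ih =
      trans (lem (size zero ys) (size (suc zero) ys) (size (suc (suc zero)) ys))
      (trans (cong (2 +_) ih) (sym (ℕ.*-suc 2 (length ys))))
      where
      lem : ∀ p q r → suc p + (suc q + (r + 0)) ≡ 2 + (p + (q + (r + 0)))
      lem = solve-∀

  -- Leaf count and lower bounds

  -- Combines 3 |U| ≤ Σ deg + 2 l + n₂ with Σ deg + 2 ≤ 2 |U|, after adding 2 |U| to both sides. As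
  -- `us` is closed under adjacency, degrees in the graph and within the list agree.
  leaf-count : ∀ {us} → 1 ≤ℕ length us → Peelable us → (∀ {v} → v ∈ us → 1 ≤ℕ degree v) →
    (∀ {v w} → v ∈ us → v ~ w → w ∈ us) →
    length us + 2 ≤ℕ 2 * length (filter (λ v → degree v ℕ.≟ 1) us)
                    + length (filter (λ v → degree v ℕ.≟ 2) us)
  leaf-count {us@(_ ∷ _)} _ pus 1≤deg closed = ℕ.+-cancelˡ-≤ (2 * length us) _ _ (begin
    2 * length us + (length us + 2)       ≡⟨ lem₁ (length us) ⟩
    3 * length us + 2                     ≤⟨ ℕ.+-monoˡ-≤ 2 (3*length≤sum degree (All.tabulate 1≤deg)) ⟩
    sum (map degree us) + leaves+two + 2  ≡⟨ cong (λ s → s + leaves+two + 2) degrees ⟩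
    degreeSum us us + leaves+two + 2      ≡⟨ lem₂ (degreeSum us us) leaves+two ⟩
    degreeSum us us + 2 + leaves+two      ≤⟨ ℕ.+-monoˡ-≤ leaves+two (peelable⇒degreeSum≤ pus) ⟩
    2 * length us + leaves+two            ∎)
    where
    open ℕ.≤-Reasoning
    leaves+two = 2 * length (filter (λ v → degree v ℕ.≟ 1) us)
                 + length (filter (λ v → degree v ℕ.≟ 2) us)
    lem₁ : ∀ u → 2 * u + (u + 2) ≡ 3 * u + 2
    lem₁ = solve-∀
    lem₂ : ∀ a b → a + b + 2 ≡ a + 2 + b
    lem₂ = solve-∀
    degrees : sum (map degree us) ≡ degreeSum us us
    degrees = cong sum (map-cong-local (All.tabulate λ {v} v∈ →
      degree≡length-neighboursIn v (peelable⇒unique pus) (closed v∈)))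

  -- The ends of the K₂ components.
  Paired : Vertex → Set
  Paired v = degree v ≡ 1 × ∃ λ u → v ~ u × degree u ≡ 1

  paired? : Decidable Paired
  paired? v = (degree v ℕ.≟ 1) ×-dec any? (λ u → (v ~? u) ×-dec (degree u ℕ.≟ 1))

  neighbour⇒1≤degree : ∀ {v w} → v ~ w → 1 ≤ℕ degree v
  neighbour⇒1≤degree v~w = ≤degree ([] ∷ []) λ { (here refl) → v~w }

  module LowerBounds (forest : Forest G) where

    vertices : List Vertex
    vertices = proj₁ (elimination-order forest _ {allFin order} ≤-refl)

    vertices-peelable : Peelable vertices
    vertices-peelable = proj₁ (proj₂ (elimination-order forest _ {allFin order} ≤-refl))

    ∈-vertices : ∀ v → v ∈ vertices
    ∈-vertices v = proj₂ (proj₂ (proj₂ (elimination-order forest _ {allFin order} ≤-refl)))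
                     (∈-allFin v)

    order≡ : order ≡ length vertices
    order≡ = trans (sym (length-tabulate {n = order} id)) (ℕ.≤-antisym
      (unique⊆⇒length≤ _≟_ (Unique.allFin⁺ order) (λ {v} _ → ∈-vertices v))
      (unique⊆⇒length≤ _≟_ (peelable⇒unique vertices-peelable) (λ {v} _ → ∈-allFin v)))

    ofDegree : ∀ d → List Vertex → List Vertex
    ofDegree d = filter (λ v → degree v ℕ.≟ d)

    isolated nonisolated paired unpaired : List Vertex
    isolated    = ofDegree 0 vertices
    nonisolated = filter (λ v → ¬? (degree v ℕ.≟ 0)) vertices
    paired      = filter paired? nonisolated
    unpaired    = filter (λ v → ¬? (paired? v)) nonisolated

    -- `path` contains all vertices of degree two, which induce disjoint paths in a forest.
    leaves path : List Vertex
    leaves = ofDegree 1 unpaired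
    path   = ofDegree 2 unpaired

    paired-peelable : Peelable paired
    paired-peelable = peelable-filter paired? (peelable-filter _ vertices-peelable)

    unpaired-peelable : Peelable unpaired
    unpaired-peelable = peelable-filter _ (peelable-filter _ vertices-peelable)

    order-partition : order ≡ length isolated + (length paired + length unpaired)
    order-partition = trans order≡ (trans
      (sym (length-filter-∁ (λ v → degree v ℕ.≟ 0) vertices))
      (cong (length isolated +_) (sym (length-filter-∁ paired? nonisolated))))

    isolated⇒degree : ∀ {v} → v ∈ isolated → degree v ≡ 0
    isolated⇒degree v∈ = proj₂ (∈-filter⁻ (λ v → degree v ℕ.≟ 0) {xs = vertices} v∈)

    paired⇒Paired : ∀ {v} → v ∈ paired → Paired v
    paired⇒Paired v∈ = proj₂ (∈-filter⁻ paired? {xs = nonisolated} v∈)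

    unpaired⇒¬Paired : ∀ {v} → v ∈ unpaired → ¬ Paired v
    unpaired⇒¬Paired v∈ = proj₂ (∈-filter⁻ (λ v → ¬? (paired? v)) {xs = nonisolated} v∈)

    leaves⇒degree : ∀ {v} → v ∈ leaves → degree v ≡ 1
    leaves⇒degree v∈ = proj₂ (∈-filter⁻ (λ v → degree v ℕ.≟ 1) {xs = unpaired} v∈)

    leaves⇒¬Paired : ∀ {v} → v ∈ leaves → ¬ Paired v
    leaves⇒¬Paired v∈ =
      unpaired⇒¬Paired (proj₁ (∈-filter⁻ (λ v → degree v ℕ.≟ 1) {xs = unpaired} v∈))

    path⇒degree : ∀ {v} → v ∈ path → degree v ≡ 2
    path⇒degree v∈ = proj₂ (∈-filter⁻ (λ v → degree v ℕ.≟ 2) {xs = unpaired} v∈)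

    path-peelable : Peelable path
    path-peelable = peelable-filter _ unpaired-peelable

    -- If `w` were paired, its only neighbour would be `v`, and `v` would be paired too.
    unpaired-closed : ∀ {v w} → v ∈ unpaired → v ~ w → w ∈ unpaired
    unpaired-closed {v} {w} v∈ v~w =
      ∈-filter⁺ (λ v → ¬? (paired? v))
        (∈-filter⁺ (λ v → ¬? (degree v ℕ.≟ 0)) (∈-vertices w)
          (ℕ.m<n⇒n≢0 (neighbour⇒1≤degree (~-sym v~w))))
        λ (deg-w , u , w~u , deg-u) →
          let deg-v = subst (λ x → degree x ≡ 1)
                        (degree≤1⇒neighbours≡ (≤-reflexive deg-w) w~u (~-sym v~w)) deg-u
          in unpaired⇒¬Paired v∈ (deg-v , w , v~w , deg-w)

    unpaired⇒1≤degree : ∀ {v} → v ∈ unpaired → 1 ≤ℕ degree v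
    unpaired⇒1≤degree v∈ = ℕ.n≢0⇒n>0 (proj₂ (∈-filter⁻ (λ v → ¬? (degree v ℕ.≟ 0)) {xs = vertices}
      (proj₁ (∈-filter⁻ (λ v → ¬? (paired? v)) {xs = nonisolated} v∈))))

    order-bound : (order ≤ℕ length isolated + length paired)
      ⊎ (order + 2 ≤ℕ length isolated + (2 * length leaves + length paired) + length path)
    order-bound with length unpaired ℕ.≟ 0
    ... | yes none = inj₁ (≤-reflexive (begin
      order                                               ≡⟨ order-partition ⟩
      length isolated + (length paired + length unpaired)
        ≡⟨ cong (λ u → length isolated + (length paired + u)) none ⟩
      length isolated + (length paired + 0)
        ≡⟨ cong (length isolated +_) (ℕ.+-identityʳ (length paired)) ⟩
      length isolated + length paired                     ∎))
      where open ≡-Reasoning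
    ... | no some = inj₂ (begin
      order + 2
        ≡⟨ cong (_+ 2) order-partition ⟩
      length isolated + (length paired + length unpaired) + 2
        ≡⟨ lem (length isolated) (length paired) (length unpaired) ⟩
      length isolated + (length paired + (length unpaired + 2))
        ≤⟨ ℕ.+-monoʳ-≤ (length isolated) (ℕ.+-monoʳ-≤ (length paired)
             (leaf-count (ℕ.n≢0⇒n>0 some) unpaired-peelable unpaired⇒1≤degree unpaired-closed)) ⟩
      length isolated + (length paired + (2 * length leaves + length path))
        ≡⟨ lem′ (length isolated) (length paired) (length leaves) (length path) ⟩
      length isolated + (2 * length leaves + length paired) + length path ∎)
      where
      open ℕ.≤-Reasoning
      lem : ∀ i p u → i + (p + u) + 2 ≡ i + (p + (u + 2))
      lem = solve-∀
      lem′ : ∀ i p l t → i + (p + (2 * l + t)) ≡ i + (2 * l + p) + t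
      lem′ = solve-∀

    isolated≤ : ∀ k → length isolated ≤ℕ α[ k ]-reg G
    isolated≤ k = length≤α-degree z≤n (Unique.filter⁺ _ (peelable⇒unique vertices-peelable))
      isolated⇒degree

    leaves++-unique : ∀ {xs} → Unique xs → (∀ {x} → x ∈ xs → Paired x) → Unique (leaves ++ xs)
    leaves++-unique xs! xs-paired =
      Unique.++⁺ (Unique.filter⁺ _ (peelable⇒unique unpaired-peelable)) xs!
        λ (x∈leaves , x∈xs) → leaves⇒¬Paired x∈leaves (xs-paired x∈xs)

    leaves++-degree : ∀ {xs} → (∀ {x} → x ∈ xs → Paired x) →
                      ∀ {v} → v ∈ leaves ++ xs → degree v ≡ 1
    leaves++-degree xs-paired v∈ =
      [ leaves⇒degree , proj₁ ∘ xs-paired ]′ (∈-++⁻ leaves v∈)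

    -- For `k` ≥ 1 both ends of each K₂ may be taken. This matters when U is empty: counting only
    -- half of them would give n + 2 ≤ 5 α, too weak for `k` ≥ 1.
    paired≤ : ∀ {k} → 1 ≤ℕ k → length paired ≤ℕ α[ k ]-reg G
    paired≤ 1≤k =
      length≤α-degree 1≤k (peelable⇒unique paired-peelable) (proj₁ ∘ paired⇒Paired)

    -- Adjacent vertices of degree one form a K₂, so a leaf of U is adjacent neither to another such
    -- leaf nor to a K₂ end. Hence an independent half of the K₂ ends can join the leaves.
    2*leaves+paired≤ : ∀ k → 2 * length leaves + length paired ≤ℕ 2 * α[ k ]-reg G
    2*leaves+paired≤ k with half-independent paired-peelable
    ... | ys , ys! , ys⊆ , independent , half = begin
      2 * length leaves + length paired ≤⟨ ℕ.+-monoʳ-≤ _ half ⟩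
      2 * length leaves + 2 * length ys ≡⟨ ℕ.*-distribˡ-+ 2 (length leaves) (length ys) ⟨
      2 * (length leaves + length ys)   ≡⟨ cong (2 *_) (length-++ leaves) ⟨
      2 * length (leaves ++ ys)         ≤⟨ *-monoʳ-≤ 2 leaves++ys≤ ⟩
      2 * α[ k ]-reg G                  ∎
      where
      open ℕ.≤-Reasoning
      ys-paired : ∀ {y} → y ∈ ys → Paired y
      ys-paired = paired⇒Paired ∘ ys⊆
      leaves++ys-degree = leaves++-degree ys-paired
      leaves++ys-independent : ∀ {u v} → u ∈ leaves ++ ys → v ∈ leaves ++ ys → ¬ u ~ v
      leaves++ys-independent u∈ v∈ u~v with ∈-++⁻ leaves u∈ | ∈-++⁻ leaves v∈
      ... | inj₁ u∈l | _ =
        leaves⇒¬Paired u∈l (leaves⇒degree u∈l , _ , u~v , leaves++ys-degree v∈)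
      ... | inj₂ _ | inj₁ v∈l =
        leaves⇒¬Paired v∈l (leaves⇒degree v∈l , _ , ~-sym u~v , leaves++ys-degree u∈)
      ... | inj₂ u∈ys | inj₂ v∈ys = independent u∈ys v∈ys u~v
      leaves++ys≤ : length (leaves ++ ys) ≤ℕ α[ k ]-reg G
      leaves++ys≤ = length≤α k (leaves++-unique ys! ys-paired)
        (λ u∈ v∈ → trans (leaves++ys-degree u∈) (sym (leaves++ys-degree v∈)))
        λ {v} v∈ → subst (λ N → length N ≤ℕ k)
          (sym (filter-none (v ~?_) (All.tabulate (leaves++ys-independent v∈)))) z≤n

    path≤2* : length path ≤ℕ 2 * α-reg G
    path≤2* with half-independent path-peelable
    ... | ys , ys! , ys⊆ , independent , half = ≤-trans half (*-monoʳ-≤ 2 (length≤α 0 ys!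
      (λ u∈ v∈ → trans (path⇒degree (ys⊆ u∈)) (sym (path⇒degree (ys⊆ v∈))))
      λ {v} v∈ → ≤-reflexive (cong length (filter-none (v ~?_) (All.tabulate (independent v∈))))))

    2*path≤3* : 2 * length path ≤ℕ 3 * α[ 1 ]-reg G
    2*path≤3* = two-thirds-1-independent path-peelable (≤-reflexive ∘ path⇒degree)
      λ ys! ys⊆ independent → length≤α 1 ys!
        (λ u∈ v∈ → trans (path⇒degree (ys⊆ u∈)) (sym (path⇒degree (ys⊆ v∈)))) independent

    path≤ : ∀ {k} → 2 ≤ℕ k → length path ≤ℕ α[ k ]-reg G
    path≤ 2≤k = length≤α-degree 2≤k (peelable⇒unique path-peelable) path⇒degree

    -- All three bounds at once, doubled because `k` = 1 leads to 9/2. The 6 is twice 1 + 2, for the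
    -- isolated vertices and for the leaves with the K₂ ends; `m` accounts for the degree-two class.
    -- For empty U, `c` gives n + 2 ≤ c a + 2 a, where a ≥ 1 follows from n ≥ 1.
    2*[order+2]≤ : 1 ≤ℕ order → ∀ k c m → 2 * c + 4 ≤ℕ 6 + m →
      length isolated + length paired ≤ℕ c * α[ k ]-reg G →
      2 * length path ≤ℕ m * α[ k ]-reg G →
      2 * (order + 2) ≤ℕ (6 + m) * α[ k ]-reg G
    2*[order+2]≤ 1≤n k c m c≤ i+p≤ 2t≤ with order-bound
    ... | inj₁ n≤ = begin
      2 * (order + 2)       ≡⟨ ℕ.*-distribˡ-+ 2 order 2 ⟩
      2 * order + 4         ≤⟨ +-mono-≤ (*-monoʳ-≤ 2 n≤ca) (*-monoʳ-≤ 4 1≤a) ⟩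
      2 * (c * a) + 4 * a   ≡⟨ lem c a ⟩
      (2 * c + 4) * a       ≤⟨ ℕ.*-monoˡ-≤ a c≤ ⟩
      (6 + m) * a           ∎
      where
      open ℕ.≤-Reasoning
      a = α[ k ]-reg G
      n≤ca : order ≤ℕ c * a
      n≤ca = ≤-trans n≤ i+p≤
      1≤a : 1 ≤ℕ a
      1≤a = ℕ.n≢0⇒n>0 λ a≡0 → ℕ.<-irrefl refl (≤-trans 1≤n (≤-trans n≤ca
              (≤-reflexive (trans (cong (c *_) a≡0) (ℕ.*-zeroʳ c)))))
      lem : ∀ c a → 2 * (c * a) + 4 * a ≡ (2 * c + 4) * a
      lem = solve-∀
    ... | inj₂ n+2≤ = begin
      2 * (order + 2)                   ≤⟨ *-monoʳ-≤ 2 n+2≤ ⟩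
      2 * (length isolated + (2 * length leaves + length paired) + length path)
        ≡⟨ ℕ.*-distribˡ-+ 2 (length isolated + (2 * length leaves + length paired)) _ ⟩
      2 * (length isolated + (2 * length leaves + length paired)) + 2 * length path
        ≤⟨ +-mono-≤ (*-monoʳ-≤ 2 (+-mono-≤ (isolated≤ k) (2*leaves+paired≤ k))) 2t≤ ⟩
      2 * (a + 2 * a) + m * a           ≡⟨ lem m a ⟩
      (6 + m) * a                       ∎
      where
      open ℕ.≤-Reasoning
      a = α[ k ]-reg G
      lem : ∀ m a → 2 * (a + 2 * a) + m * a ≡ (6 + m) * a
      lem = solve-∀

  halve : ∀ {n} c a → 2 * n ≤ℕ (2 * c) * a → n ≤ℕ c * a
  halve c a 2n≤ = ℕ.*-cancelˡ-≤ 2 (≤-trans 2n≤ (≤-reflexive (ℕ.*-assoc 2 c a)))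

  module _ (forest : Forest G) (1≤n : 1 ≤ℕ order) where
    open LowerBounds forest

    α-reg-bound : order + 2 ≤ℕ 5 * α-reg G
    -- `c` = 3 adds α for the isolated vertices and 2 α for the K₂ ends; `m` = 4 is twice the factor
    -- in `path≤2*`.
    α-reg-bound = halve 5 (α-reg G) (2*[order+2]≤ 1≤n 0 3 4 ≤-refl
      (+-mono-≤ (isolated≤ 0) (≤-trans (ℕ.m≤n+m _ (2 * length leaves)) (2*leaves+paired≤ 0)))
      (≤-trans (*-monoʳ-≤ 2 path≤2*) (≤-reflexive (sym (ℕ.*-assoc 2 2 (α-reg G))))))

    α-1-reg-bound : 2 * (order + 2) ≤ℕ 9 * α[ 1 ]-reg G
    α-1-reg-bound = 2*[order+2]≤ 1≤n 1 2 3 (ℕ.n≤1+n 8)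
      (+-mono-≤ (isolated≤ 1) (≤-trans (paired≤ ≤-refl) (ℕ.m≤m+n _ 0))) 2*path≤3*

    α-k-reg-bound : ∀ k → 2 ≤ℕ k → order + 2 ≤ℕ 4 * α[ k ]-reg G
    α-k-reg-bound k 2≤k = halve 4 (α[ k ]-reg G) (2*[order+2]≤ 1≤n k 2 2 ≤-refl
      (+-mono-≤ (isolated≤ k) (≤-trans (paired≤ (≤-trans (ℕ.n≤1+n 1) 2≤k)) (ℕ.m≤m+n _ 0)))
      (*-monoʳ-≤ 2 (path≤ 2≤k)))

-- Sharpness

χ : Bool → ℕ
χ b = if b then 1 else 0

-- Kronecker delta. Bounding a set of vertices of degree `d` by a sum of terms `δ a d` treats all
-- values of `d` at once.
δ : ℕ → ℕ → ℕ
δ a d = χ (does (a ℕ.≟ d))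

∣∷∣ : ∀ b {n} (S : Subset n) → ∣ b ∷ S ∣ ≡ χ b + ∣ S ∣
∣∷∣ true  _ = refl
∣∷∣ false _ = refl

χ≤δ : ∀ b {a d} → (b ≡ true → a ≡ d) → χ b ≤ℕ δ a d
χ≤δ false _ = z≤n
χ≤δ true {a} {d} a≡d = ≤-reflexive (sym (cong χ (dec-true (a ℕ.≟ d) (a≡d refl))))

-- A record, so that the subset can be inferred from the bound.
infix 4 _≼_
record _≼_ {n} (S : Subset n) (m : ℕ) : Set where
  constructor bounded
  field size≤ : ∣ S ∣ ≤ℕ m

open _≼_

[]≼ : [] ≼ 0
[]≼ = bounded z≤n

≼-size : ∀ {n} {S : Subset n} → S ≼ ∣ S ∣
≼-size = bounded ≤-refl

module _ (a d : ℕ) {n m : ℕ} {S : Subset n} where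

  ∷≼ : ∀ {b} → (b ≡ true → a ≡ d) → S ≼ m → b ∷ S ≼ δ a d + m
  ∷≼ {b} hb S≼ .size≤ = ≤-trans (≤-reflexive (∣∷∣ b S)) (+-mono-≤ (χ≤δ b hb) (S≼ .size≤))

  -- Two vertices that exclude each other, as neighbours do for k = 0, cost only one.
  ∷∷≼ : ∀ {b c} → (b ≡ true → a ≡ d) → (c ≡ true → a ≡ d) →
        (b ≡ true → c ≡ true → ⊥) → S ≼ m → b ∷ c ∷ S ≼ δ a d + m
  ∷∷≼ {false}        _  hc _     S≼ .size≤ = ∷≼ hc S≼ .size≤
  ∷∷≼ {true} {false} hb _  _     S≼ .size≤ = ∷≼ hb S≼ .size≤
  ∷∷≼ {true} {true}  _  _  ¬both _         = ⊥-elim (¬both refl refl)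

-- Three vertices that cannot all be chosen, as on a path of order 3 for k = 1, cost only two.
∷∷∷≼ : ∀ a d {n m} {S : Subset n} {b c e} →
       (b ≡ true → a ≡ d) → (c ≡ true → a ≡ d) → (e ≡ true → a ≡ d) →
       (b ≡ true → c ≡ true → e ≡ true → ⊥) → S ≼ m →
       b ∷ c ∷ e ∷ S ≼ δ a d + (δ a d + m)
∷∷∷≼ a d {b = false}            _  hc he _    S≼ .size≤ = ∷≼ a d hc (∷≼ a d he S≼) .size≤
∷∷∷≼ a d {b = true} {c = false} hb _  he _    S≼ .size≤ = ∷≼ a d hb (∷≼ a d he S≼) .size≤
∷∷∷≼ a d {b = true} {c = true}  hb hc he ¬all S≼ .size≤ =
  ∷≼ a d hb (∷∷≼ a d hc he (λ _ e → ¬all refl refl e) S≼) .size≤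

-- At most one of the four degrees equals `d`, so a block that costs one unit in each degree
-- enlarges every bound by at most 1.
δ-sum≤1 : ∀ d → δ 0 d + δ 1 d + δ 2 d + δ 3 d ≤ℕ 1
δ-sum≤1 0 = ≤-refl
δ-sum≤1 1 = ≤-refl
δ-sum≤1 2 = ≤-refl
δ-sum≤1 3 = ≤-refl
δ-sum≤1 (suc (suc (suc (suc _)))) = z≤n

-- A forest grown one vertex at a time: the new vertex zero is joined to its
-- parent, if any, among the old vertices.
infixr 5 _◂_
data Growth : ℕ → Set where
  ∅   : Growth 0
  _◂_ : ∀ {n} → Maybe (Fin n) → Growth n → Growth (suc n)

-- Recursion on the growth makes edges between explicitly given vertices hold by `refl`.
Adj : ∀ {n} → Growth n → Fin n → Fin n → Set
Adj (p ◂ T) zero    zero    = ⊥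
Adj (p ◂ T) zero    (suc v) = p ≡ just v
Adj (p ◂ T) (suc u) zero    = p ≡ just u
Adj (p ◂ T) (suc u) (suc v) = Adj T u v

adj? : ∀ {n} (T : Growth n) u v → Dec (Adj T u v)
adj? (p ◂ T) zero    zero    = no id
adj? (p ◂ T) zero    (suc v) = ≡-dec _≟_ p (just v)
adj? (p ◂ T) (suc u) zero    = ≡-dec _≟_ p (just u)
adj? (p ◂ T) (suc u) (suc v) = adj? T u v

adj-sym : ∀ {n} (T : Growth n) {u v} → Adj T u v → Adj T v u
adj-sym (p ◂ T) {zero}  {suc v} u~v = u~v
adj-sym (p ◂ T) {suc u} {zero}  u~v = u~v
adj-sym (p ◂ T) {suc u} {suc v} u~v = adj-sym T u~v

adj-irrefl : ∀ {n} (T : Growth n) {u v} → u ≡ v → ¬ Adj T u v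
adj-irrefl (p ◂ T) {suc u} refl u~u = adj-irrefl T refl u~u

graph : ∀ {n} → Growth n → Graph
graph {n} T = record
  { order = n ; _~_ = Adj T ; _~?_ = adj? T ; ~-sym = adj-sym T ; ~-irrefl = adj-irrefl T }

-- Older vertices have larger indices, so a larger neighbour can only be the parent.
parent-unique : ∀ {n} (T : Growth n) {u v w} → Adj T u v → Adj T u w →
                u Fin.< v → u Fin.< w → v ≡ w
parent-unique (p ◂ T) {zero} {suc v} {suc w} refl refl _ _ = refl
parent-unique (p ◂ T) {suc u} {suc v} {suc w} u~v u~w u<v u<w =
  cong suc (parent-unique T u~v u~w (s≤s⁻¹ u<v) (s≤s⁻¹ u<w))

-- Acyclicity from an order of the vertices

module _ (G : Graph) where
  open Graph G

  inner-neighbours : ∀ {a w ps} → Linked _~_ (a ∷ ps ++ [ w ]) → a ∉ ps → w ∉ ps → a ≢ w →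
    Unique ps → ∀ {x} → x ∈ ps →
    ∃₂ λ y z → y ∈ a ∷ ps × z ∈ ps ++ [ w ] × x ~ y × x ~ z × y ≢ z
  inner-neighbours {ps = _ ∷ []} (a~x ∷ x~w ∷ _) _ _ a≢w _ (here refl) =
    _ , _ , here refl , there (here refl) , ~-sym a~x , x~w , a≢w
  inner-neighbours {ps = _ ∷ _ ∷ _} (a~x ∷ x~q ∷ _) a∉ _ _ _ (here refl) =
    _ , _ , here refl , there (here refl) , ~-sym a~x , x~q , λ a≡q → a∉ (there (here a≡q))
  inner-neighbours {ps = p ∷ _} (_ ∷ linked) _ w∉ _ (p∉ ∷ ps!) (there x∈)
    with inner-neighbours linked (All.All¬⇒¬Any p∉) (w∉ ∘ there) (λ p≡w → w∉ (here (sym p≡w))) ps! x∈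
  ... | y , z , y∈ , z∈ , rest = y , z , there y∈ , there z∈ , rest

  last-neighbour : ∀ {a w} ps → Linked _~_ (a ∷ ps ++ [ w ]) → ∃ λ y → y ∈ a ∷ ps × y ~ w
  last-neighbour []       (a~w ∷ _)    = _ , here refl , a~w
  last-neighbour (p ∷ ps) (_ ∷ linked) with last-neighbour ps linked
  ... | y , y∈ , y~w = y , there y∈ , y~w

  -- The first two vertices are treated apart: the neighbours of `v` are `b` and the last vertex of
  -- the cycle, those of `b` are `v` and `c`. All others are inner vertices of the path from `b`
  -- back to `v`.
  cycle⇒twoNeighbours : ∀ {v vs} → IsCycle v vs → ∀ {x} → x ∈ v ∷ vs → TwoNeighbours G (v ∷ vs) x
  cycle⇒twoNeighbours {vs = []} (() , _)
  cycle⇒twoNeighbours {vs = _ ∷ []} (s≤s () , _)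
  cycle⇒twoNeighbours {v} {b ∷ c ∷ rs} (_ , v∉ ∷ b∉ ∷ cs! , v~b ∷ b~c ∷ linked) = two
    where
    two : ∀ {x} → x ∈ v ∷ b ∷ c ∷ rs → TwoNeighbours G (v ∷ b ∷ c ∷ rs) x
    two (here refl) with last-neighbour rs linked
    ... | y , y∈ , y~v =
      b , y , there (here refl) , there (there y∈) , v~b , ~-sym y~v , All.lookup b∉ y∈
    two (there (here refl)) =
      v , c , here refl , there (there (here refl)) , ~-sym v~b , b~c , All.lookup v∉ (there (here refl))
    two (there (there x∈))
      with inner-neighbours (b~c ∷ linked) (All.All¬⇒¬Any b∉) (All.All¬⇒¬Any (All.tail v∉))
             (All.head v∉ ∘ sym) cs! x∈
    ... | y , z , y∈ , z∈ , rest =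
      y , z , there y∈ , on-cycle (∈-++⁻ (c ∷ rs) z∈) , rest
      where
      on-cycle : ∀ {z} → z ∈ c ∷ rs ⊎ z ∈ [ v ] → z ∈ v ∷ b ∷ c ∷ rs
      on-cycle (inj₁ z∈cs)       = there (there z∈cs)
      on-cycle (inj₂ (here z≡v)) = here z≡v

  -- Descending along the cycle from any vertex never stops.
  unique-larger-neighbour⇒forest :
    (∀ {u v w} → u ~ v → u ~ w → u Fin.< v → u Fin.< w → v ≡ w) → Forest G
  unique-larger-neighbour⇒forest unique v vs cycle =
    descend (<-wellFounded v) (here refl)
    where
    descend : ∀ {x} → Acc Fin._<_ x → ¬ x ∈ v ∷ vs
    descend {x} (acc smaller) x∈ with cycle⇒twoNeighbours cycle x∈
    ... | y , z , y∈ , z∈ , x~y , x~z , y≢z with <-cmp x y | <-cmp x z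
    ...   | tri< x<y _ _ | tri< x<z _ _ = y≢z (unique x~y x~z x<y x<z)
    ...   | tri≈ _ x≡y _ | _            = ~-irrefl x≡y x~y
    ...   | tri> _ _ y<x | _            = descend (smaller y<x) y∈
    ...   | _            | tri≈ _ x≡z _ = ~-irrefl x≡z x~z
    ...   | _            | tri> _ _ z<x = descend (smaller z<x) z∈

  independent⇒length≤ : ∀ {k S v xs} → Independent k S → v ∈ₛ S → Unique xs →
    (∀ {x} → x ∈ xs → x ∈ₛ S × v ~ x) → length xs ≤ℕ k
  independent⇒length≤ {S = S} {v} independent v∈S xs! xs⊆ = ≤-trans
    (length≤∣p∣ xs! λ x∈ → let x∈S , v~x = xs⊆ x∈ in
      x∈p∩q⁺ (∈-comprehension⁺ (v ~?_) v~x , x∈S))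
    (independent v v∈S)

  0-independent⇒¬adjacent : ∀ {S} → Independent 0 S → ∀ {u v} → u ∈ₛ S → v ∈ₛ S → ¬ u ~ v
  0-independent⇒¬adjacent independent {v = v} u∈ v∈ u~v =
    contradiction (independent⇒length≤ {xs = [ v ]} independent u∈ ([] ∷ [])
      λ { (here refl) → v∈ , u~v }) λ ()

  1-independent⇒neighbours≡ : ∀ {S} → Independent 1 S → ∀ {u v w} →
    u ∈ₛ S → v ∈ₛ S → w ∈ₛ S → u ~ v → u ~ w → v ≡ w
  1-independent⇒neighbours≡ independent {u} {v} {w} u∈ v∈ w∈ u~v u~w =
    decidable-stable (v ≟ w) λ v≢w → contradiction
      (independent⇒length≤ {xs = v ∷ w ∷ []} independent u∈ ((v≢w ∷ []) ∷ [] ∷ [])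
        λ { (here refl) → v∈ , u~v ; (there (here refl)) → w∈ , u~w })
      λ { (s≤s ()) }

graph-forest : ∀ {n} (T : Growth n) → Forest (graph T)
graph-forest T = unique-larger-neighbour⇒forest (graph T) (parent-unique T)

-- A recursive form of `degree` that computes on the newest vertices of a growth even when the older
-- part is a variable.
deg : ∀ {n} → Growth n → Fin n → ℕ
deg (p ◂ T) zero    = length (fromMaybe p)
deg (p ◂ T) (suc v) = χ (does (≡-dec _≟_ p (just v))) + deg T v

degree≡deg : ∀ {n} (T : Growth n) v → Graph.degree (graph T) v ≡ deg T v
degree≡deg (p ◂ T) zero = ℕ.≤-antisym
  (∣p∣≤length (to p ∘ ∈-comprehension⁻ (λ v → ≡-dec _≟_ p (just v))))
  (length≤∣p∣ (unique p) (∈-comprehension⁺ (λ v → ≡-dec _≟_ p (just v)) ∘ from p))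
  where
  unique : ∀ p → Unique (fromMaybe p)
  unique (just _) = [] ∷ []
  unique nothing  = []
  to : ∀ p {v} → p ≡ just v → v ∈ fromMaybe p
  to _ refl = here refl
  from : ∀ p {v} → v ∈ fromMaybe p → p ≡ just v
  from (just _) (here refl) = refl
degree≡deg (p ◂ T) (suc v) =
  trans (∣∷∣ (does (≡-dec _≟_ p (just v))) (Graph.neighbours (graph T) v))
        (cong (χ (does (≡-dec _≟_ p (just v))) +_) (degree≡deg T v))

_∈ᵇ_ : ∀ {n} → Fin n → Subset n → Set
v ∈ᵇ S = Vec.lookup S v ≡ true

OfDegree : ∀ {n} → (Fin n → ℕ) → ℕ → Subset n → Set
OfDegree f d S = ∀ v → v ∈ᵇ S → f v ≡ d

-- A set attaining the maximum has a common degree `d`, read off at any of its vertices; the empty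
-- set needs its own case because it offers none.
α≤ : ∀ {n} k (T : Growth n) {m} →
     (∀ d S → OfDegree (deg T) d S → Graph.Independent (graph T) k S → ∣ S ∣ ≤ℕ m) →
     α[ k ]-reg (graph T) ≤ℕ m
α≤ k T {m} bound with α-reg-attained k (graph T)
... | S , (independent , equal) , ∣S∣≡α with nonempty? S
...   | yes (u , u∈S) = subst (_≤ℕ m) ∣S∣≡α (bound (deg T u) S
          (λ v v∈S → trans (sym (degree≡deg T v))
            (trans (equal v u (lookup⇒[]= v S v∈S) u∈S) (degree≡deg T u)))
          independent)
...   | no empty = subst (_≤ℕ m) ∣S∣≡α (≤-trans
          (∣p∣≤length {xs = []} λ x∈S → contradiction (_ , x∈S) empty) z≤n)

module _ {n} (T : Growth (suc n)) where

  ∷-bound : ∀ {d m b} {S : Subset n} → deg T zero ≡ 1 → OfDegree (deg T) d (b ∷ S) →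
            ∣ S ∣ + δ 1 d ≤ℕ m → ∣ b ∷ S ∣ ≤ℕ m
  ∷-bound {d} {m} {b} {S} leaf h S≤ = begin
    ∣ b ∷ S ∣     ≤⟨ ∷≼ 1 d (λ e → trans (sym leaf) (h zero e)) (≼-size {S = S}) .size≤ ⟩
    δ 1 d + ∣ S ∣ ≡⟨ ℕ.+-comm (δ 1 d) ∣ S ∣ ⟩
    ∣ S ∣ + δ 1 d ≤⟨ S≤ ⟩
    m             ∎
    where open ℕ.≤-Reasoning

-- The vertex zero of each member of the families below is a leaf. In the next
-- member it receives another leaf and a new branch, which ends in the new vertex
-- zero; isolated vertices and vertices of degree two balance the degree classes.
-- The summand δ 1 d in the bounds for S leaves room for the vertex zero.

sharp₀ : ∀ i → Growth (8 + i * 5)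
-- A path of order 6 and two isolated vertices: two leaves, and four vertices of degree two of which
-- two can be chosen.
sharp₀ zero    = just 0F ◂ just 0F ◂ just 0F ◂ just 0F ◂ just 0F ◂ nothing ◂ nothing ◂ nothing ◂ ∅
-- Gains of a step: one isolated vertex, one leaf (two new, the old one lost), one vertex of degree
-- 3, and two adjacent vertices of degree two, of which one can be chosen.
sharp₀ (suc i) = just 1F ◂ nothing ◂ just 0F ◂ just 1F ◂ just 0F ◂ sharp₀ i

sharp₀-leaf : ∀ i → deg (sharp₀ i) zero ≡ 1
sharp₀-leaf zero    = refl
sharp₀-leaf (suc _) = refl

-- Vertex zero is left out because it alone changes its degree in the next member; the degrees of
-- the other old vertices stay definitionally the same, so the induction hypothesis applies to them
-- directly.
tail-bound₀ : ∀ i d S → OfDegree (deg (sharp₀ i) ∘ suc) d S →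
  (∀ u v → u ∈ᵇ S → v ∈ᵇ S → ¬ Adj (sharp₀ i) (suc u) (suc v)) →
  ∣ S ∣ + δ 1 d ≤ℕ 2 + i
tail-bound₀ zero d (x₁ ∷ x₂ ∷ x₃ ∷ x₄ ∷ y ∷ w₁ ∷ w₂ ∷ []) h ind = begin
  ∣ x₁ ∷ x₂ ∷ x₃ ∷ x₄ ∷ y ∷ w₁ ∷ w₂ ∷ [] ∣ + δ 1 d
    ≤⟨ ℕ.+-monoˡ-≤ (δ 1 d) (members .size≤) ⟩
  δ 2 d + (δ 2 d + (δ 1 d + (δ 0 d + (δ 0 d + 0)))) + δ 1 d
    ≡⟨ lem (δ 0 d) (δ 1 d) (δ 2 d) ⟩
  2 * (δ 0 d + δ 1 d + δ 2 d)
    ≤⟨ *-monoʳ-≤ 2 (≤-trans (ℕ.m≤m+n _ (δ 3 d)) (δ-sum≤1 d)) ⟩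
  2 ∎
  where
  open ℕ.≤-Reasoning
  lem : ∀ p q r → r + (r + (q + (p + (p + 0)))) + q ≡ 2 * (p + q + r)
  lem = solve-∀
  members : x₁ ∷ x₂ ∷ x₃ ∷ x₄ ∷ y ∷ w₁ ∷ w₂ ∷ [] ≼ δ 2 d + (δ 2 d + (δ 1 d + (δ 0 d + (δ 0 d + 0))))
  members =
    ∷∷≼ 2 d (h 0F) (h 1F) (λ e e′ → ind 0F 1F e e′ refl)
    (∷∷≼ 2 d (h 2F) (h 3F) (λ e e′ → ind 2F 3F e e′ refl)
    (∷≼ 1 d (h 4F)
    (∷≼ 0 d (h 5F)
    (∷≼ 0 d (h 6F) []≼))))
tail-bound₀ (suc i) d (w ∷ x₁ ∷ x₂ ∷ y ∷ l ∷ S) h ind = begin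
  ∣ w ∷ x₁ ∷ x₂ ∷ y ∷ l ∷ S ∣ + δ 1 d
    ≤⟨ ℕ.+-monoˡ-≤ (δ 1 d) (members .size≤) ⟩
  δ 0 d + (δ 2 d + (δ 1 d + (δ 3 d + ∣ S ∣))) + δ 1 d
    ≡⟨ lem (δ 0 d) (δ 1 d) (δ 2 d) (δ 3 d) ∣ S ∣ ⟩
  δ 0 d + δ 1 d + δ 2 d + δ 3 d + (∣ S ∣ + δ 1 d)
    ≤⟨ +-mono-≤ (δ-sum≤1 d)
         (tail-bound₀ i d S (λ v → h (5 ↑ʳ v))
           (λ u v → ind (5 ↑ʳ u) (5 ↑ʳ v))) ⟩
  2 + suc i ∎
  where
  open ℕ.≤-Reasoning
  lem : ∀ p q r t s → p + (r + (q + (t + s))) + q ≡ p + q + r + t + (s + q)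
  lem = solve-∀
  members : w ∷ x₁ ∷ x₂ ∷ y ∷ l ∷ S ≼ δ 0 d + (δ 2 d + (δ 1 d + (δ 3 d + ∣ S ∣)))
  members =
    ∷≼ 0 d (h 0F)
    (∷∷≼ 2 d (h 1F) (h 2F) (λ e e′ → ind 1F 2F e e′ refl)
    (∷≼ 1 d (h 3F)
    -- `l` was the leaf zero of the previous member and has gained two neighbours.
    (∷≼ 3 d (λ e → trans (cong (2 +_) (sym (sharp₀-leaf i))) (h 4F e)) ≼-size)))

α-sharp₀ : ∀ i → α[ 0 ]-reg (graph (sharp₀ i)) ≤ℕ 2 + i
α-sharp₀ i = α≤ 0 (sharp₀ i) λ { d (b ∷ S) h independent → ∷-bound (sharp₀ i) (sharp₀-leaf i) h
  (tail-bound₀ i d S (h ∘ suc)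
    λ u v u∈ v∈ → 0-independent⇒¬adjacent (graph (sharp₀ i)) independent
      (lookup⇒[]= (suc u) (b ∷ S) u∈) (lookup⇒[]= (suc v) (b ∷ S) v∈)) }

-- Starts from a path of order 5 and two isolated vertices. Gains of a step: two isolated vertices,
-- two leaves (three new, one lost), two vertices of degree 3, and a path of three vertices of
-- degree two, of which two can be chosen.
sharp₁ : ∀ i → Growth (7 + i * 9)
sharp₁ zero    = just 0F ◂ just 0F ◂ just 0F ◂ just 0F ◂ nothing ◂ nothing ◂ nothing ◂ ∅
sharp₁ (suc i) = just 2F ◂ nothing ◂ nothing ◂ just 0F ◂ just 0F
                 ◂ just 1F ◂ just 0F ◂ just 1F ◂ just 0F ◂ sharp₁ i

sharp₁-leaf : ∀ i → deg (sharp₁ i) zero ≡ 1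
sharp₁-leaf zero    = refl
sharp₁-leaf (suc _) = refl

tail-bound₁ : ∀ i d S → OfDegree (deg (sharp₁ i) ∘ suc) d S →
  (∀ u v w → u ∈ᵇ S → v ∈ᵇ S → w ∈ᵇ S →
    Adj (sharp₁ i) (suc u) (suc v) → Adj (sharp₁ i) (suc u) (suc w) → v ≡ w) →
  ∣ S ∣ + δ 1 d ≤ℕ 2 + i * 2
tail-bound₁ zero d (x₁ ∷ x₂ ∷ x₃ ∷ y ∷ w₁ ∷ w₂ ∷ []) h ind = begin
  ∣ x₁ ∷ x₂ ∷ x₃ ∷ y ∷ w₁ ∷ w₂ ∷ [] ∣ + δ 1 d
    ≤⟨ ℕ.+-monoˡ-≤ (δ 1 d) (members .size≤) ⟩
  δ 2 d + (δ 2 d + (δ 1 d + (δ 0 d + (δ 0 d + 0)))) + δ 1 d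
    ≡⟨ lem (δ 0 d) (δ 1 d) (δ 2 d) ⟩
  2 * (δ 0 d + δ 1 d + δ 2 d)
    ≤⟨ *-monoʳ-≤ 2 (≤-trans (ℕ.m≤m+n _ (δ 3 d)) (δ-sum≤1 d)) ⟩
  2 ∎
  where
  open ℕ.≤-Reasoning
  lem : ∀ p q r → r + (r + (q + (p + (p + 0)))) + q ≡ 2 * (p + q + r)
  lem = solve-∀
  members : x₁ ∷ x₂ ∷ x₃ ∷ y ∷ w₁ ∷ w₂ ∷ [] ≼ δ 2 d + (δ 2 d + (δ 1 d + (δ 0 d + (δ 0 d + 0))))
  members =
    ∷∷∷≼ 2 d (h 0F) (h 1F) (h 2F)
      -- All three together would give the middle vertex `x₂` two neighbours in the set.
      (λ e e′ e″ → contradiction (ind 1F 0F 2F e′ e e″ refl refl) λ ())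
    (∷≼ 1 d (h 3F)
    (∷≼ 0 d (h 4F)
    (∷≼ 0 d (h 5F) []≼)))
tail-bound₁ (suc i) d (w₁ ∷ w₂ ∷ x₁ ∷ x₂ ∷ x₃ ∷ y₁ ∷ l₁ ∷ y ∷ l ∷ S) h ind = begin
  ∣ w₁ ∷ w₂ ∷ x₁ ∷ x₂ ∷ x₃ ∷ y₁ ∷ l₁ ∷ y ∷ l ∷ S ∣ + δ 1 d
    ≤⟨ ℕ.+-monoˡ-≤ (δ 1 d) (members .size≤) ⟩
  δ 0 d + (δ 0 d + (δ 2 d + (δ 2 d + (δ 1 d + (δ 3 d + (δ 1 d + (δ 3 d + ∣ S ∣))))))) + δ 1 d
    ≡⟨ lem (δ 0 d) (δ 1 d) (δ 2 d) (δ 3 d) ∣ S ∣ ⟩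
  2 * (δ 0 d + δ 1 d + δ 2 d + δ 3 d) + (∣ S ∣ + δ 1 d)
    ≤⟨ +-mono-≤ (*-monoʳ-≤ 2 (δ-sum≤1 d))
         (tail-bound₁ i d S (λ v → h (9 ↑ʳ v))
           (λ u v w u∈ v∈ w∈ u~v u~w → ↑ʳ-injective 9 v w
             (ind (9 ↑ʳ u) (9 ↑ʳ v) (9 ↑ʳ w) u∈ v∈ w∈ u~v u~w))) ⟩
  2 + suc i * 2 ∎
  where
  open ℕ.≤-Reasoning
  lem : ∀ p q r t s → p + (p + (r + (r + (q + (t + (q + (t + s))))))) + q ≡ 2 * (p + q + r + t) + (s + q)
  lem = solve-∀
  members : w₁ ∷ w₂ ∷ x₁ ∷ x₂ ∷ x₃ ∷ y₁ ∷ l₁ ∷ y ∷ l ∷ S ≼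
    δ 0 d + (δ 0 d + (δ 2 d + (δ 2 d + (δ 1 d + (δ 3 d + (δ 1 d + (δ 3 d + ∣ S ∣)))))))
  members =
    ∷≼ 0 d (h 0F)
    (∷≼ 0 d (h 1F)
    (∷∷∷≼ 2 d (h 2F) (h 3F) (h 4F)
      (λ e e′ e″ → contradiction (ind 3F 2F 4F e′ e e″ refl refl) λ ())
    (∷≼ 1 d (h 5F)
    (∷≼ 3 d (h 6F)
    (∷≼ 1 d (h 7F)
    (∷≼ 3 d (λ e → trans (cong (2 +_) (sym (sharp₁-leaf i))) (h 8F e)) ≼-size))))))

α-sharp₁ : ∀ i → α[ 1 ]-reg (graph (sharp₁ i)) ≤ℕ 2 + i * 2
α-sharp₁ i = α≤ 1 (sharp₁ i) λ { d (b ∷ S) h independent → ∷-bound (sharp₁ i) (sharp₁-leaf i) h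
  (tail-bound₁ i d S (h ∘ suc)
    λ u v w u∈ v∈ w∈ u~v u~w → suc-injective
      (1-independent⇒neighbours≡ (graph (sharp₁ i)) independent
        (lookup⇒[]= (suc u) (b ∷ S) u∈) (lookup⇒[]= (suc v) (b ∷ S) v∈)
        (lookup⇒[]= (suc w) (b ∷ S) w∈) u~v u~w)) }

-- Starts from a path of order 4 and two isolated vertices; each step enlarges every degree class
-- from 0 to 3 by one.
sharp₂ : ∀ i → Growth (6 + i * 4)
sharp₂ zero    = just 0F ◂ just 0F ◂ just 0F ◂ nothing ◂ nothing ◂ nothing ◂ ∅
sharp₂ (suc i) = just 1F ◂ nothing ◂ just 1F ◂ just 0F ◂ sharp₂ i

sharp₂-leaf : ∀ i → deg (sharp₂ i) zero ≡ 1
sharp₂-leaf zero    = refl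
sharp₂-leaf (suc _) = refl

tail-bound₂ : ∀ i d S → OfDegree (deg (sharp₂ i) ∘ suc) d S →
  ∣ S ∣ + δ 1 d ≤ℕ 2 + i
tail-bound₂ zero d (x₁ ∷ x₂ ∷ y ∷ w₁ ∷ w₂ ∷ []) h = begin
  ∣ x₁ ∷ x₂ ∷ y ∷ w₁ ∷ w₂ ∷ [] ∣ + δ 1 d
    ≤⟨ ℕ.+-monoˡ-≤ (δ 1 d) (members .size≤) ⟩
  δ 2 d + (δ 2 d + (δ 1 d + (δ 0 d + (δ 0 d + 0)))) + δ 1 d
    ≡⟨ lem (δ 0 d) (δ 1 d) (δ 2 d) ⟩
  2 * (δ 0 d + δ 1 d + δ 2 d)
    ≤⟨ *-monoʳ-≤ 2 (≤-trans (ℕ.m≤m+n _ (δ 3 d)) (δ-sum≤1 d)) ⟩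
  2 ∎
  where
  open ℕ.≤-Reasoning
  lem : ∀ p q r → r + (r + (q + (p + (p + 0)))) + q ≡ 2 * (p + q + r)
  lem = solve-∀
  members : x₁ ∷ x₂ ∷ y ∷ w₁ ∷ w₂ ∷ [] ≼ δ 2 d + (δ 2 d + (δ 1 d + (δ 0 d + (δ 0 d + 0))))
  members =
    ∷≼ 2 d (h 0F)
    (∷≼ 2 d (h 1F)
    (∷≼ 1 d (h 2F)
    (∷≼ 0 d (h 3F)
    (∷≼ 0 d (h 4F) []≼))))
tail-bound₂ (suc i) d (w ∷ x ∷ y ∷ l ∷ S) h = begin
  ∣ w ∷ x ∷ y ∷ l ∷ S ∣ + δ 1 d
    ≤⟨ ℕ.+-monoˡ-≤ (δ 1 d) (members .size≤) ⟩
  δ 0 d + (δ 2 d + (δ 1 d + (δ 3 d + ∣ S ∣))) + δ 1 d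
    ≡⟨ lem (δ 0 d) (δ 1 d) (δ 2 d) (δ 3 d) ∣ S ∣ ⟩
  δ 0 d + δ 1 d + δ 2 d + δ 3 d + (∣ S ∣ + δ 1 d)
    ≤⟨ +-mono-≤ (δ-sum≤1 d)
         (tail-bound₂ i d S (λ v → h (4 ↑ʳ v))) ⟩
  2 + suc i ∎
  where
  open ℕ.≤-Reasoning
  lem : ∀ p q r t s → p + (r + (q + (t + s))) + q ≡ p + q + r + t + (s + q)
  lem = solve-∀
  members : w ∷ x ∷ y ∷ l ∷ S ≼ δ 0 d + (δ 2 d + (δ 1 d + (δ 3 d + ∣ S ∣)))
  members =
    ∷≼ 0 d (h 0F)
    (∷≼ 2 d (h 1F)
    (∷≼ 1 d (h 2F)
    (∷≼ 3 d (λ e → trans (cong (2 +_) (sym (sharp₂-leaf i))) (h 3F e)) ≼-size)))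

-- Already the whole degree classes have at most `2 + i` vertices, so one family serves every `k`.
α-sharp₂ : ∀ k i → α[ k ]-reg (graph (sharp₂ i)) ≤ℕ 2 + i
α-sharp₂ k i = α≤ k (sharp₂ i) λ { d (b ∷ S) h _ → ∷-bound (sharp₂ i) (sharp₂-leaf i) h
  (tail-bound₂ i d S (h ∘ suc)) }

-- From natural numbers to rationals

open import Data.Integer.Base using (+_)
open import Data.Rational.Base using (_/_; _≤_; toℚᵘ; fromℚᵘ)
open Graph using (order)

-- `_/_` reduces to lowest terms; in the unnormalised rationals the comparison is a plain cross
-- multiplication.
/≤/1 : ∀ n a c → n ≤ℕ suc c * a → (+ n) / suc c ≤ (+ a) / 1
/≤/1 n a c n≤ca = ℚ.toℚᵘ-cancel-≤ (begin
  toℚᵘ (fromℚᵘ (mkℚᵘ (+ n) c)) ≃⟨ ℚ.toℚᵘ-fromℚᵘ (mkℚᵘ (+ n) c) ⟩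
  mkℚᵘ (+ n) c                 ≤⟨ *≤* (subst₂ ℤ._≤_ (pos-* n 1) (pos-* a (suc c)) (ℤ.+≤+ n*1≤)) ⟩
  mkℚᵘ (+ a) 0                 ≃⟨ ℚ.toℚᵘ-fromℚᵘ (mkℚᵘ (+ a) 0) ⟨
  toℚᵘ (fromℚᵘ (mkℚᵘ (+ a) 0)) ∎)
  where
  open ℚᵘ.≤-Reasoning
  n*1≤ : n * 1 ≤ℕ a * suc c
  n*1≤ = subst₂ _≤ℕ_ (sym (ℕ.*-identityʳ n)) (ℕ.*-comm (suc c) a) n≤ca

/1≡/ : ∀ n a c → n ≤ℕ suc c * a → suc c * a ≤ℕ n → (+ a) / 1 ≡ (+ n) / suc c
/1≡/ n a c n≤ca ca≤n = ℚ.fromℚᵘ-cong {mkℚᵘ (+ a) 0} {mkℚᵘ (+ n) c} (*≡* (begin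
  + a ℤ.* + suc c ≡⟨ pos-* a (suc c) ⟨
  + (a * suc c)   ≡⟨ cong +_ (trans (ℕ.*-comm a (suc c)) (ℕ.≤-antisym ca≤n n≤ca)) ⟩
  + n             ≡⟨ cong +_ (ℕ.*-identityʳ n) ⟨
  + (n * 1)       ≡⟨ pos-* n 1 ⟩
  + n ℤ.* + 1     ∎))
  where open ≡-Reasoning

-- Isomorphic graphs have equal order, and `b + i * s` with `s` nonzero is injective in `i`. `m`
-- gives the numerator and `suc c` the denominator of the extremal value.
infinitely-many-equal : ∀ k c (m : Graph → ℕ) b s .{{_ : NonZero s}}
  (T : ∀ i → Growth (b + i * s)) →
  (∀ i → m (graph (T i)) ≤ℕ suc c * α[ k ]-reg (graph (T i))) →
  (∀ i → suc c * α[ k ]-reg (graph (T i)) ≤ℕ m (graph (T i))) →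
  InfinitelyManyForests (λ F → (+ α[ k ]-reg F) / 1 ≡ (+ m F) / suc c)
infinitely-many-equal k c m b s T m≤ ≤m =
    (λ i → graph (T i))
  , (λ i → graph-forest (T i)
         , /1≡/ (m (graph (T i))) (α[ k ]-reg (graph (T i))) c (m≤ i) (≤m i))
  , λ i j (vertices↔ , _) → ℕ.*-cancelʳ-≡ i j s (ℕ.+-cancelˡ-≡ b _ _ (↔⇒≡ vertices↔))

theorem2p2 : ((F : Graph) → Forest F → 1 ≤ℕ order F →
    ((+ (order F + 2)) / 5 ≤ (+ α-reg F) / 1)
    × ((+ (2 * (order F + 2))) / 9 ≤ (+ α[ 1 ]-reg F) / 1)
    × ((k : ℕ) → 2 ≤ℕ k → (+ (order F + 2)) / 4 ≤ (+ α[ k ]-reg F) / 1))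
    × InfinitelyManyForests (λ F → (+ α-reg F) / 1 ≡ (+ (order F + 2)) / 5)
    × InfinitelyManyForests (λ F → (+ α[ 1 ]-reg F) / 1 ≡ (+ (2 * (order F + 2))) / 9)
    × ((k : ℕ) → 2 ≤ℕ k → InfinitelyManyForests (λ F → (+ α[ k ]-reg F) / 1 ≡ (+ (order F + 2)) / 4))
theorem2p2 =
    (λ F forest 1≤n →
        /≤/1 (order F + 2) (α-reg F) 4 (α-reg-bound F forest 1≤n)
      , /≤/1 (2 * (order F + 2)) (α[ 1 ]-reg F) 8 (α-1-reg-bound F forest 1≤n)
      , λ k 2≤k → /≤/1 (order F + 2) (α[ k ]-reg F) 3 (α-k-reg-bound F forest 1≤n k 2≤k))
  , infinitely-many-equal 0 4 (λ F → order F + 2) 8 5 sharp₀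
      (λ i → α-reg-bound (graph (sharp₀ i)) (graph-forest (sharp₀ i)) (s≤s z≤n))
      (λ i → ≤-trans (*-monoʳ-≤ 5 (α-sharp₀ i)) (≤-reflexive (order₀ i)))
  , infinitely-many-equal 1 8 (λ F → 2 * (order F + 2)) 7 9 sharp₁
      (λ i → α-1-reg-bound (graph (sharp₁ i)) (graph-forest (sharp₁ i)) (s≤s z≤n))
      (λ i → ≤-trans (*-monoʳ-≤ 9 (α-sharp₁ i)) (≤-reflexive (order₁ i)))
  , λ k 2≤k → infinitely-many-equal k 3 (λ F → order F + 2) 6 4 sharp₂
      (λ i → α-k-reg-bound (graph (sharp₂ i)) (graph-forest (sharp₂ i)) (s≤s z≤n) k 2≤k)
      (λ i → ≤-trans (*-monoʳ-≤ 4 (α-sharp₂ k i)) (≤-reflexive (order₂ i)))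
  where
  order₀ : ∀ i → 5 * (2 + i) ≡ 8 + i * 5 + 2
  order₀ = solve-∀
  order₁ : ∀ i → 9 * (2 + i * 2) ≡ 2 * (7 + i * 9 + 2)
  order₁ = solve-∀
  order₂ : ∀ i → 4 * (2 + i) ≡ 6 + i * 4 + 2
  order₂ = solve-∀
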